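{- Let $\mathcal{P}=(\mathscr{P}_n(x))_{n\ge 0}$ be a sequence of real polynomials with nonnegative coefficients, $\deg(\mathscr{P}_n(x))=n$, satisfying $$\mathscr{P}_{n+1}(x)=p_n(x)\mathscr{P}_n(x)+q(x)\,\frac{d}{dx}\mathscr{P}_n(x)\qquad (n\ge 0)$$ with real polynomials $p_n(x)$, $q(x)$, and assume $\mathscr{P}_n(x)\ll\mathscr{P}_{n+1}(x)$ for all $n$. For $n\ge 1$ let $r_1,\dots,r_n$ be all the zeros of $\mathscr{P}_n(x)$, and suppose that there are a real polynomial $h_n(x)$ and real numbers $a_{k_i}$ (depending on $n$, $1\le k\le n$, $0\le i\le 3$) such that $$(x-r_k)\bigl[p_n(x)-p_{n-1}(x)\bigr]+q(x)=h_n(x)\sum_{i=0}^{3}a_{k_i}(x-r_k)^i\qquad(1\le k\le n).$$ Assume that $h_n(x)$ is Hurwitz stable for each $n$. If, for each $n$, all elements of $\bigcup_{k=1}^n\{ -a_{k_3},a_{k_1},a_{k_0}\}$ have the same sign (all $\ge 0$ or all $\le 0$), and the values $h_n(x)\sum_{i=0}^{3}a_{k_i}(x-r_k)^i$ have the same sign for all $1\le k\le n$ and all $x>0$, then $$\mathfrak{I}_n(\mathcal{P};x):=(\mathscr{P}_{n+1}(x))^2-\mathscr{P}_{n+2}(x)\mathscr{P}_n(x)$$ is Hurwitz stable for each $n$.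
   Context: A polynomial $f\in\mathbb{C}[x]$ is Hurwitz stable if it is identically zero or $f(x)\ne0$ whenever $\Re(x)>0$. For real-rooted real polynomials $f,g$ with zeros $\{r_i\}$, $\{s_j\}$ listed in decreasing order, write $g\preceq f$ if either $\deg f=\deg g+1=n$ and $r_n\le s_{n-1}\le\cdots\le s_2\le r_2\le s_1\le r_1$, or $\deg f=\deg g=n$ and $s_n\le r_n\le\cdots\le s_2\le r_2\le s_1\le r_1$. Write $g\ll f$ if $g\preceq f$ and the leading coefficients of $f,g$ have the same sign, or $f\preceq g$ and the leading coefficients of $f,g$ have opposite sign. In particular $\mathscr{P}_n\ll\mathscr{P}_{n+1}$ includes that both are real-rooted. -}

module Defs where

open import Level using (Level; _⊔_; suc)
open import Algebra.Bundles using (CommutativeRing)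
open import Algebra.Bundles.Raw using (RawRing)
import Algebra.Definitions.RawSemiring as RawSemiringDefinitions
open import Data.Fin.Base as Fin using (Fin; toℕ; inject₁)
open import Data.List.Base using (List; []; _∷_; map; foldr)
open import Data.Nat.Base as ℕ using (ℕ; zero)
open import Data.Product.Base using (Σ; ∃; _×_; _,_; proj₁; proj₂)
open import Data.Sum.Base using (_⊎_)
open import Relation.Binary.Core using (Rel)
open import Relation.Binary.PropositionalEquality.Core using (_≡_)
open import Relation.Binary.Structures using (IsDecTotalOrder)
import Relation.Binary.Construct.NonStrictToStrict as ToStrict
open import Relation.Nullary.Negation.Core using (¬_)
open import Relation.Unary using (Pred; Satisfiable; _∈_; _⊆_)

-- The library has no real numbers.  Here ℝ is given by its categorical
-- axioms: a (decidably, i.e. classically) totally ordered field in which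
-- every nonempty set that is bounded above has a least upper bound.

record CompleteOrderedField (c ℓ₁ ℓ₂ : Level) : Set (suc (c ⊔ ℓ₁ ⊔ ℓ₂)) where
  infix 4 _≤_ _<_
  field
    commutativeRing : CommutativeRing c ℓ₁
  open CommutativeRing commutativeRing public
  field
    0≉1      : 0# ≉ 1#
    inverse  : ∀ x → x ≉ 0# → ∃ λ y → x * y ≈ 1#
    _≤_      : Rel Carrier ℓ₂
    isDecTotalOrder : IsDecTotalOrder _≈_ _≤_
    +-monoʳ-≤ : ∀ x {y z} → y ≤ z → x + y ≤ x + z
    *-nonNeg  : ∀ {x y} → 0# ≤ x → 0# ≤ y → 0# ≤ x * y

  _<_ : Rel Carrier (ℓ₁ ⊔ ℓ₂)
  _<_ = ToStrict._<_ _≈_ _≤_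

  UpperBound : ∀ {ℓ} → Pred Carrier ℓ → Pred Carrier (c ⊔ ℓ₂ ⊔ ℓ)
  UpperBound S u = ∀ {x} → x ∈ S → x ≤ u

  field
    supremum : (S : Pred Carrier (c ⊔ ℓ₁ ⊔ ℓ₂)) →
               Satisfiable S → Satisfiable (UpperBound S) →
               ∃ λ s → UpperBound S s × (∀ u → UpperBound S u → s ≤ u)

-- A polynomial is the list of its coefficients, constant term first.
-- Trailing zeros are allowed, so equality of polynomials is _≈ₚ_, not _≡_.

module Polynomial {c ℓ : Level} (R : RawRing c ℓ) where
  open RawRing R

  Poly : Set c
  Poly = List Carrier

  coeff : Poly → ℕ → Carrier
  coeff []      _         = 0#
  coeff (a ∷ f) zero      = a
  coeff (a ∷ f) (ℕ.suc k) = coeff f k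

  infix 4 _≈ₚ_
  _≈ₚ_ : Rel Poly ℓ
  f ≈ₚ g = ∀ k → coeff f k ≈ coeff g k

  infixl 6 _+ₚ_ _-ₚ_
  infixl 7 _*ₚ_
  infix  8 -ₚ_

  _+ₚ_ : Poly → Poly → Poly
  []      +ₚ g       = g
  (a ∷ f) +ₚ []      = a ∷ f
  (a ∷ f) +ₚ (b ∷ g) = a + b ∷ f +ₚ g

  -ₚ_ : Poly → Poly
  -ₚ_ = map -_

  _-ₚ_ : Poly → Poly → Poly
  f -ₚ g = f +ₚ (-ₚ g)

  _*ₚ_ : Poly → Poly → Poly
  []      *ₚ g = []
  (a ∷ f) *ₚ g = map (a *_) g +ₚ (0# ∷ f *ₚ g)

  C : Carrier → Poly
  C a = a ∷ []

  X : Poly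
  X = 0# ∷ 1# ∷ []

  polyRawRing : RawRing c ℓ
  polyRawRing = record
    { Carrier = Poly ; _≈_ = _≈ₚ_ ; _+_ = _+ₚ_ ; _*_ = _*ₚ_
    ; -_ = -ₚ_ ; 0# = [] ; 1# = C 1# }

  open RawSemiringDefinitions (RawRing.rawSemiring polyRawRing) public
    using () renaming (sum to sumₚ; product to productₚ; _^_ to _^ₚ_)

  -- (a + x f)′ = f + x f′
  derivative : Poly → Poly
  derivative []      = []
  derivative (a ∷ f) = f +ₚ (0# ∷ derivative f)

  eval : Poly → Carrier → Carrier
  eval f x = foldr (λ a v → a + x * v) 0# f

  -- The zero polynomial has no degree.
  HasDegree : Poly → ℕ → Set ℓ
  HasDegree f n = coeff f n ≉ 0# × (∀ k → n ℕ.< k → coeff f k ≈ 0#)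

  LeadingCoeff : Poly → Carrier → Set ℓ
  LeadingCoeff f a = ∃ λ n → HasDegree f n × a ≈ coeff f n

  -- deg f = n and r lists all n zeros of f, with multiplicity.
  AllZeros : ∀ {n} → Poly → (Fin n → Carrier) → Set ℓ
  AllZeros {n} f r =
    HasDegree f n × f ≈ₚ C (coeff f n) *ₚ productₚ (λ i → X -ₚ C (r i))

module Complex {c ℓ₁ ℓ₂ : Level} (𝓡 : CompleteOrderedField c ℓ₁ ℓ₂) where
  open CompleteOrderedField 𝓡

  ℂ : Set c
  ℂ = Carrier × Carrier

  Re Im : ℂ → Carrier
  Re = proj₁
  Im = proj₂

  ℂ-rawRing : RawRing c ℓ₁
  ℂ-rawRing = record
    { Carrier = ℂ
    ; _≈_     = λ z w → Re z ≈ Re w × Im z ≈ Im w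
    ; _+_     = λ z w → Re z + Re w , Im z + Im w
    ; _*_     = λ z w → Re z * Re w - Im z * Im w , Re z * Im w + Im z * Re w
    ; -_      = λ z → - Re z , - Im z
    ; 0#      = 0# , 0#
    ; 1#      = 1# , 0#
    }

  open RawRing ℂ-rawRing using () renaming (_≈_ to _≈ᶜ_; 0# to 0ᶜ)
  private module ℂ[x] = Polynomial ℂ-rawRing

  HurwitzStable : ℂ[x].Poly → Set (c ⊔ ℓ₁ ⊔ ℓ₂)
  HurwitzStable f =
    f ℂ[x].≈ₚ [] ⊎ (∀ z → 0# < Re z → ¬ (ℂ[x].eval f z ≈ᶜ 0ᶜ))

module RealPolynomial {c ℓ₁ ℓ₂ : Level} (𝓡 : CompleteOrderedField c ℓ₁ ℓ₂) where
  open CompleteOrderedField 𝓡 public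
    using (_≤_; _<_; 0#; -_; _≈_) renaming (Carrier to ℝ)
  open Polynomial (CommutativeRing.rawRing (CompleteOrderedField.commutativeRing 𝓡)) public
  open Complex 𝓡 public using (ℂ; HurwitzStable)

  toℂ[x] : Poly → List ℂ
  toℂ[x] = map (_, 0#)

  NonnegativeCoefficients : Poly → Set ℓ₂
  NonnegativeCoefficients f = ∀ k → 0# ≤ coeff f k

  Decreasing : ∀ {n} → (Fin n → ℝ) → Set ℓ₂
  Decreasing r = ∀ i j → i Fin.≤ j → r j ≤ r i

  ZerosInDecreasingOrder : ∀ {n} → Poly → (Fin n → ℝ) → Set (ℓ₁ ⊔ ℓ₂)
  ZerosInDecreasingOrder f r = AllZeros f r × Decreasing r

  infix 4 _⪯_ _≪_

  -- Zeros are numbered from 0.  In the first case deg f = m + 1 and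
  -- deg g = m; in the second both degrees are n.
  _⪯_ : Rel Poly (c ⊔ ℓ₁ ⊔ ℓ₂)
  g ⪯ f =
    (∃ λ m → Σ (Fin (ℕ.suc m) → ℝ) λ r → Σ (Fin m → ℝ) λ s →
      ZerosInDecreasingOrder f r × ZerosInDecreasingOrder g s ×
      (∀ i → r (Fin.suc i) ≤ s i × s i ≤ r (inject₁ i)))
    ⊎
    (∃ λ n → Σ (Fin n → ℝ) λ r → Σ (Fin n → ℝ) λ s →
      ZerosInDecreasingOrder f r × ZerosInDecreasingOrder g s ×
      (∀ i → s i ≤ r i) ×
      (∀ i j → toℕ j ≡ ℕ.suc (toℕ i) → r j ≤ s i))

  LeadingCoeffsSameSign : Rel Poly (c ⊔ ℓ₁ ⊔ ℓ₂)
  LeadingCoeffsSameSign f g = ∃ λ a → ∃ λ b →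
    LeadingCoeff f a × LeadingCoeff g b × ((0# < a × 0# < b) ⊎ (a < 0# × b < 0#))

  LeadingCoeffsOppositeSign : Rel Poly (c ⊔ ℓ₁ ⊔ ℓ₂)
  LeadingCoeffsOppositeSign f g = ∃ λ a → ∃ λ b →
    LeadingCoeff f a × LeadingCoeff g b × ((0# < a × b < 0#) ⊎ (a < 0# × 0# < b))

  _≪_ : Rel Poly (c ⊔ ℓ₁ ⊔ ℓ₂)
  g ≪ f = (g ⪯ f × LeadingCoeffsSameSign f g)
        ⊎ (f ⪯ g × LeadingCoeffsOppositeSign f g)

  SameSign : ∀ {ℓ} → Pred ℝ ℓ → Set (c ⊔ ℓ₂ ⊔ ℓ)
  SameSign S = (S ⊆ (0# ≤_)) ⊎ (S ⊆ (_≤ 0#))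

  cubicAt : ℝ → (Fin 4 → ℝ) → Poly
  cubicAt r a = sumₚ (λ i → C (a i) *ₚ (X -ₚ C r) ^ₚ toℕ i)

  ℑ : (ℕ → Poly) → ℕ → Poly
  ℑ P n = P (1 ℕ.+ n) ^ₚ 2 -ₚ P (2 ℕ.+ n) *ₚ P n

module Submission where

-- Write P = P_{n+1} = e ∏ (x − r_k).  Interlacing gives P_n = Σ_k b_k Q_k with b_k ≥ 0 and
-- Q_k = e⁻¹ P / (x − r_k), so the two recurrences turn P² − P_{n+2} P_n into
--   − Σ_k e b_k Q_k² ((x − r_k)(p_{n+1} − p_n) + q) = − e h Σ_k b_k Q_k² Σ_i a_{k,i} (x − r_k)^i.
-- Dividing by ∏ (x − r_k)² leaves Σ_k b_k (a_{k,3} w + a_{k,2} + a_{k,1} / w + a_{k,0} / w²) with w = x − r_k,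
-- where Re w > 0 when Re x > 0.  At a non-real zero the imaginary parts all have the same sign,
-- so they vanish and the real parts Σ_k b_k a_{k,2} have terms of one sign.  At a real zero all
-- terms have one sign, so every cubic vanishes there; by the sign pattern of (−a₃, a₁, a₀) a nonzero
-- cubic would change sign.  Hence all b_k a_{k,i} are zero and the polynomial vanishes identically.

open import Defs
open import Algebra.Bundles using (CommutativeRing; Semiring)
import Algebra.Definitions.RawSemiring as RawSemiringDefinitions
import Algebra.Morphism.Construct.Composition as Composition
import Algebra.Morphism.Construct.Identity as Identity
open import Algebra.Morphism.Structures using (module RingMorphisms)
import Algebra.Properties.CommutativeMonoid.Sum as CommutativeMonoidSum
import Algebra.Properties.Ring as RingProperties
import Algebra.Properties.Semiring.Mult.TCOptimised as Multiples
import Algebra.Properties.Semiring.Sum as SemiringSum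
import Algebra.Solver.Ring as RingSolver
open import Algebra.Solver.Ring.AlmostCommutativeRing
  using (fromCommutativeRing; _-Raw-AlmostCommutative⟶_)
open import Data.Empty using (⊥-elim)
open import Data.Fin.Base using (Fin; zero; suc; toℕ; inject₁; punchIn)
open import Data.Fin.Patterns using (0F; 1F; 2F; 3F)
open import Data.Fin.Properties using (all?)
open import Data.Integer.Base as ℤ using (ℤ; +_; -[1+_]; _⊖_; _◃_; ∣_∣; sign)
import Data.Integer.Properties as ℤₚ
open import Data.List.Base as List using ([]; _∷_)
import Data.Maybe.Base as Maybe
open import Data.Nat.Base as ℕ using (ℕ; zero; suc; pred; z≤n; s≤s) renaming (_≤_ to _≤ℕ_)
open import Data.Nat.Properties using (<-cmp; n<1+n; 1+n≢n; <-trans; <-irrefl) renaming (+-suc to ℕ-+-suc)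
open import Data.Product.Base using (∃; ∃₂; Σ; _×_; _,_; proj₁; proj₂)
open import Data.Sign.Base as Sign using (Sign)
open import Data.Sum.Base using (_⊎_; inj₁; inj₂)
open import Data.Vec.Functional using (removeAt)
open import Function.Base using (_∘_; id)
open import Relation.Binary.Definitions using (Decidable; tri<; tri≈; tri>)
open import Relation.Binary.PropositionalEquality.Core as ≡ using (_≡_)
import Relation.Binary.Reasoning.Setoid as SetoidReasoning
open import Relation.Binary.Structures using (IsDecTotalOrder)
open import Relation.Nullary.Decidable using (Dec; yes; no; _×-dec_; dec⇒maybe)
open import Relation.Nullary.Negation.Core using (¬_; contradiction)
open import Relation.Unary using (Pred; _∈_)

-- Identities are proved between values at a point of a commutative ring over ℝ rather than between
-- coefficient lists. Derivatives enter by evaluating at z + ε with ε² = 0: the partial fractions of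
-- P_n hold at every point with the same real b_k, so reading them at a dual point differentiates
-- them. Coefficients come back only at the end, from vanishing on the whole real line. The b_k are
-- built by induction from convex combinations instead. At a real zero x₀ the sign hypothesis
-- concerns the product of h with a cubic, not the cubic alone, so a sign change of the cubic is no
-- contradiction by itself. It forces h to change sign at x₀ as well, hence to vanish there, which
-- Hurwitz stability excludes. The passage from sign change to zero uses an explicit Lipschitz bound
-- in place of continuity.

module IntegerSolver {c ℓ} (R : CommutativeRing c ℓ) where
  open CommutativeRing R
  open RingProperties ring
  open Multiples semiring using (1+×; ×-homo-+; ×1-homo-*) renaming (_×_ to _×′_)
  open SetoidReasoning setoid

  -- Solver coefficients come from ℤ because its equality is decidable, while `R` is an arbitrary
  -- commutative ring. Soundness needs a homomorphism only, so the map may fail to be injective.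
  fromℤ : ℤ → Carrier
  fromℤ (+ n)      = n ×′ 1#
  fromℤ (-[1+ n ]) = - (suc n ×′ 1#)

  private
    [x+y]-[x+z] : ∀ x y z → (x + y) - (x + z) ≈ y - z
    [x+y]-[x+z] x y z = begin
      (x + y) - (x + z)     ≈⟨ +-cong (+-comm y x) (-‿+-comm x z) ⟨
      (y + x) + (- x - z)   ≈⟨ +-assoc y x _ ⟩
      y + (x + (- x - z))   ≈⟨ +-congˡ (+-assoc x _ _) ⟨
      y + ((x - x) - z)     ≈⟨ +-congˡ (+-congʳ (-‿inverseʳ x)) ⟩
      y + (0# - z)          ≈⟨ +-congˡ (+-identityˡ _) ⟩
      y - z                 ∎

    ⊖-homo : ∀ m n → fromℤ (m ⊖ n) ≈ m ×′ 1# - n ×′ 1#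
    ⊖-homo zero    zero    = sym (-‿inverseʳ 0#)
    ⊖-homo zero    (suc n) = sym (+-identityˡ _)
    ⊖-homo (suc m) zero    = sym (trans (+-congˡ -0#≈0#) (+-identityʳ _))
    ⊖-homo (suc m) (suc n) = begin
      fromℤ (suc m ⊖ suc n)              ≡⟨ ≡.cong fromℤ (ℤₚ.[1+m]⊖[1+n]≡m⊖n m n) ⟩
      fromℤ (m ⊖ n)                      ≈⟨ ⊖-homo m n ⟩
      m ×′ 1# - n ×′ 1#                    ≈⟨ [x+y]-[x+z] 1# _ _ ⟨
      (1# + m ×′ 1#) - (1# + n ×′ 1#)      ≈⟨ +-cong (1+× m 1#) (-‿cong (1+× n 1#)) ⟨
      suc m ×′ 1# - suc n ×′ 1#            ∎

    +-homo : ∀ i j → fromℤ (i ℤ.+ j) ≈ fromℤ i + fromℤ j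
    +-homo (+ m)    (+ n)    = ×-homo-+ 1# m n
    +-homo (+ m)    -[1+ n ] = ⊖-homo m (suc n)
    +-homo -[1+ m ] (+ n)    = trans (⊖-homo n (suc m)) (+-comm _ _)
    +-homo -[1+ m ] -[1+ n ] = begin
      - (suc (suc (m ℕ.+ n)) ×′ 1#)         ≡⟨ ≡.cong (λ k → - (suc k ×′ 1#)) (≡.sym (ℕ-+-suc m n)) ⟩
      - ((suc m ℕ.+ suc n) ×′ 1#)           ≈⟨ -‿cong (×-homo-+ 1# (suc m) (suc n)) ⟩
      - (suc m ×′ 1# + suc n ×′ 1#)          ≈⟨ -‿+-comm _ _ ⟨
      - (suc m ×′ 1#) - suc n ×′ 1#          ∎

    signed : Sign → Carrier → Carrier
    signed Sign.+ x = x
    signed Sign.- x = - x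

    signed-cong : ∀ s {x y} → x ≈ y → signed s x ≈ signed s y
    signed-cong Sign.+ = id
    signed-cong Sign.- = -‿cong

    ◃-homo : ∀ s n → fromℤ (s ◃ n) ≈ signed s (n ×′ 1#)
    ◃-homo Sign.+ zero    = refl
    ◃-homo Sign.- zero    = sym -0#≈0#
    ◃-homo Sign.+ (suc n) = refl
    ◃-homo Sign.- (suc n) = refl

    signed-* : ∀ s t x y → signed (s Sign.* t) (x * y) ≈ signed s x * signed t y
    signed-* Sign.+ Sign.+ x y = refl
    signed-* Sign.+ Sign.- x y = -‿distribʳ-* x y
    signed-* Sign.- Sign.+ x y = -‿distribˡ-* x y
    signed-* Sign.- Sign.- x y = begin
      x * y           ≈⟨ -‿involutive _ ⟨
      - - (x * y)     ≈⟨ -‿cong (-‿distribˡ-* x y) ⟩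
      - (- x * y)     ≈⟨ -‿distribʳ-* (- x) y ⟩
      - x * - y       ∎

    fromℤ-signed : ∀ i → fromℤ i ≈ signed (sign i) (∣ i ∣ ×′ 1#)
    fromℤ-signed (+ n)    = refl
    fromℤ-signed -[1+ n ] = refl

    -- Integer multiplication is defined through sign and absolute value, so the two are followed
    -- separately through `signed`.
    *-homo : ∀ i j → fromℤ (i ℤ.* j) ≈ fromℤ i * fromℤ j
    *-homo i j = begin
      fromℤ (sign i Sign.* sign j ◃ ∣ i ∣ ℕ.* ∣ j ∣)
        ≈⟨ ◃-homo (sign i Sign.* sign j) (∣ i ∣ ℕ.* ∣ j ∣) ⟩
      signed (sign i Sign.* sign j) ((∣ i ∣ ℕ.* ∣ j ∣) ×′ 1#)
        ≈⟨ signed-cong (sign i Sign.* sign j) (×1-homo-* ∣ i ∣ ∣ j ∣) ⟩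
      signed (sign i Sign.* sign j) (∣ i ∣ ×′ 1# * ∣ j ∣ ×′ 1#)
        ≈⟨ signed-* (sign i) (sign j) _ _ ⟩
      signed (sign i) (∣ i ∣ ×′ 1#) * signed (sign j) (∣ j ∣ ×′ 1#)
        ≈⟨ *-cong (fromℤ-signed i) (fromℤ-signed j) ⟨
      fromℤ i * fromℤ j ∎

    -‿homo : ∀ i → fromℤ (ℤ.- i) ≈ - fromℤ i
    -‿homo (+ zero)  = sym -0#≈0#
    -‿homo (+ suc n) = refl
    -‿homo -[1+ n ]  = sym (-‿involutive _)

    morphism : ℤ.+-*-rawRing -Raw-AlmostCommutative⟶ fromCommutativeRing R
    morphism = record
      { ⟦_⟧ = fromℤ ; +-homo = +-homo ; *-homo = *-homo
      ; -‿homo = -‿homo ; 0-homo = refl ; 1-homo = refl }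

  open RingSolver ℤ.+-*-rawRing (fromCommutativeRing R) morphism
    (λ i j → Maybe.map (reflexive ∘ ≡.cong fromℤ) (dec⇒maybe (i ℤₚ.≟ j)))
    public using (solve; _:=_; _:+_; _:*_; _:-_; :-_; con)

-- Quadratic extensions: complex numbers for δ = -1, dual numbers for δ = 0

-- R[t]/(t² − δ), with x + y t represented as (x , y).
module QuadraticExtension {c ℓ} (R : CommutativeRing c ℓ) (δ : CommutativeRing.Carrier R) where
  open CommutativeRing R
  open IntegerSolver R

  adjoin : CommutativeRing c ℓ
  adjoin = record
    { Carrier = Carrier × Carrier
    ; _≈_ = λ z w → proj₁ z ≈ proj₁ w × proj₂ z ≈ proj₂ w
    ; _+_ = λ z w → proj₁ z + proj₁ w , proj₂ z + proj₂ w
    ; _*_ = λ z w → proj₁ z * proj₁ w + δ * (proj₂ z * proj₂ w) , proj₁ z * proj₂ w + proj₂ z * proj₁ w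
    ; -_  = λ z → - proj₁ z , - proj₂ z
    ; 0#  = 0# , 0#
    ; 1#  = 1# , 0#
    ; isCommutativeRing = record
      { isRing = record
        { +-isAbelianGroup = record
          { isGroup = record
            { isMonoid = record
              { isSemigroup = record
                { isMagma = record
                  { isEquivalence = record
                    { refl = refl , refl
                    ; sym = λ (p , p′) → sym p , sym p′
                    ; trans = λ (p , p′) (q , q′) → trans p q , trans p′ q′
                    }
                  ; ∙-cong = λ (p , p′) (q , q′) → +-cong p q , +-cong p′ q′
                  }
                ; assoc = λ _ _ _ → +-assoc _ _ _ , +-assoc _ _ _
                }
              ; identity = (λ _ → +-identityˡ _ , +-identityˡ _)
                         , (λ _ → +-identityʳ _ , +-identityʳ _)
              }
            ; inverse = (λ _ → -‿inverseˡ _ , -‿inverseˡ _)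
                      , (λ _ → -‿inverseʳ _ , -‿inverseʳ _)
            ; ⁻¹-cong = λ (p , p′) → -‿cong p , -‿cong p′
            }
          ; comm = λ _ _ → +-comm _ _ , +-comm _ _
          }
        ; *-cong = λ (p , p′) (q , q′) →
            +-cong (*-cong p q) (*-congˡ (*-cong p′ q′)) , +-cong (*-cong p q′) (*-cong p′ q)
        ; *-assoc = λ (x , x′) (y , y′) (z , z′) →
            solve 7 (λ d x x′ y y′ z z′ →
              (x :* y :+ d :* (x′ :* y′)) :* z :+ d :* ((x :* y′ :+ x′ :* y) :* z′) :=
              x :* (y :* z :+ d :* (y′ :* z′)) :+ d :* (x′ :* (y :* z′ :+ y′ :* z)))
              refl δ x x′ y y′ z z′ ,
            solve 7 (λ d x x′ y y′ z z′ →
              (x :* y :+ d :* (x′ :* y′)) :* z′ :+ (x :* y′ :+ x′ :* y) :* z :=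
              x :* (y :* z′ :+ y′ :* z) :+ x′ :* (y :* z :+ d :* (y′ :* z′)))
              refl δ x x′ y y′ z z′
        ; *-identity =
            (λ (x , x′) →
              solve 3 (λ d x x′ → con (+ 1) :* x :+ d :* (con (+ 0) :* x′) := x) refl δ x x′ ,
              solve 2 (λ x x′ → con (+ 1) :* x′ :+ con (+ 0) :* x := x′) refl x x′) ,
            (λ (x , x′) →
              solve 3 (λ d x x′ → x :* con (+ 1) :+ d :* (x′ :* con (+ 0)) := x) refl δ x x′ ,
              solve 2 (λ x x′ → x :* con (+ 0) :+ x′ :* con (+ 1) := x′) refl x x′)
        ; distrib =
            (λ (x , x′) (y , y′) (z , z′) →
              solve 7 (λ d x x′ y y′ z z′ →
                x :* (y :+ z) :+ d :* (x′ :* (y′ :+ z′)) :=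
                (x :* y :+ d :* (x′ :* y′)) :+ (x :* z :+ d :* (x′ :* z′)))
                refl δ x x′ y y′ z z′ ,
              solve 6 (λ x x′ y y′ z z′ →
                x :* (y′ :+ z′) :+ x′ :* (y :+ z) :=
                (x :* y′ :+ x′ :* y) :+ (x :* z′ :+ x′ :* z))
                refl x x′ y y′ z z′) ,
            (λ (x , x′) (y , y′) (z , z′) →
              solve 7 (λ d x x′ y y′ z z′ →
                (y :+ z) :* x :+ d :* ((y′ :+ z′) :* x′) :=
                (y :* x :+ d :* (y′ :* x′)) :+ (z :* x :+ d :* (z′ :* x′)))
                refl δ x x′ y y′ z z′ ,
              solve 6 (λ x x′ y y′ z z′ →
                (y :+ z) :* x′ :+ (y′ :+ z′) :* x :=
                (y :* x′ :+ y′ :* x) :+ (z :* x′ :+ z′ :* x))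
                refl x x′ y y′ z z′)
        }
      ; *-comm = λ (x , x′) (y , y′) →
          solve 5 (λ d x x′ y y′ → x :* y :+ d :* (x′ :* y′) := y :* x :+ d :* (y′ :* x′))
            refl δ x x′ y y′ ,
          solve 4 (λ x x′ y y′ → x :* y′ :+ x′ :* y := y :* x′ :+ y′ :* x) refl x x′ y y′
      }
    }

  open RingMorphisms rawRing (CommutativeRing.rawRing adjoin) using (IsRingHomomorphism)

  embed : Carrier → CommutativeRing.Carrier adjoin
  embed x = x , 0#

  embed-isRingHomomorphism : IsRingHomomorphism embed
  embed-isRingHomomorphism = record
    { isSemiringHomomorphism = record
      { isNearSemiringHomomorphism = record
        { +-isMonoidHomomorphism = record
          { isMagmaHomomorphism = record
            { isRelHomomorphism = record { cong = λ p → p , refl }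
            ; homo = λ _ _ → refl , sym (+-identityʳ 0#)
            }
          ; ε-homo = refl , refl
          }
        ; *-homo = λ x y →
            solve 3 (λ d x y → x :* y := x :* y :+ d :* (con (+ 0) :* con (+ 0))) refl δ x y ,
            solve 2 (λ x y → con (+ 0) := x :* con (+ 0) :+ con (+ 0) :* y) refl x y
        }
      ; 1#-homo = refl , refl
      }
    ; -‿homo = λ _ → refl , solve 0 (con (+ 0) := :- con (+ 0)) refl
    }

-- Cubics, and evaluation of polynomials along a ring homomorphism

module _ {c ℓ} (S : CommutativeRing c ℓ) where
  open CommutativeRing S

  cubic : (Fin 4 → Carrier) → Carrier → Carrier
  cubic a w = a 0F + a 1F * w + a 2F * (w * w) + a 3F * (w * w * w)

  -- cubic a w / w² for j = w⁻¹
  reciprocalCubic : (Fin 4 → Carrier) → Carrier → Carrier → Carrier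
  reciprocalCubic a w j = a 0F * (j * j) + a 1F * j + a 2F + a 3F * w

module Evaluation {c ℓ} (R S : CommutativeRing c ℓ)
  {φ : CommutativeRing.Carrier R → CommutativeRing.Carrier S}
  (φ-isHom : RingMorphisms.IsRingHomomorphism (CommutativeRing.rawRing R) (CommutativeRing.rawRing S) φ)
  (z : CommutativeRing.Carrier S) where

  private module R = CommutativeRing R
  open CommutativeRing S hiding (zero)
  open RingMorphisms.IsRingHomomorphism φ-isHom
  open RingProperties ring using (-0#≈0#)
  open Polynomial R.rawRing
  open IntegerSolver S
  open SetoidReasoning setoid
  open RawSemiringDefinitions (Semiring.rawSemiring semiring) using (sum; product; _^_)

  -- Carrying `φ` along lets one set of lemmas serve real, complex and dual points. For the identity
  -- homomorphism `ev z f` unfolds to `eval f z`, so these lemmas apply to `eval` without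
  -- conversion.
  ev : Poly → Carrier
  ev = List.foldr (λ a v → φ a + z * v) 0#

  ev-zero : ∀ f → (∀ k → coeff f k R.≈ R.0#) → ev f ≈ 0#
  ev-zero []      f≈0 = refl
  ev-zero (a ∷ f) f≈0 = begin
    φ a + z * ev f    ≈⟨ +-cong (trans (⟦⟧-cong (f≈0 0)) 0#-homo) (*-congˡ (ev-zero f (f≈0 ∘ suc))) ⟩
    0# + z * 0#       ≈⟨ solve 1 (λ z → con (+ 0) :+ z :* con (+ 0) := con (+ 0)) refl z ⟩
    0#                ∎

  ev-cong : ∀ f g → f ≈ₚ g → ev f ≈ ev g
  ev-cong []      g       f≈g = sym (ev-zero g (λ k → R.sym (f≈g k)))
  ev-cong (a ∷ f) []      f≈g = ev-zero (a ∷ f) f≈g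
  ev-cong (a ∷ f) (b ∷ g) f≈g =
    +-cong (⟦⟧-cong (f≈g 0)) (*-congˡ (ev-cong f g (f≈g ∘ suc)))

  ev-+ : ∀ f g → ev (f +ₚ g) ≈ ev f + ev g
  ev-+ []      g       = sym (+-identityˡ _)
  ev-+ (a ∷ f) []      = sym (+-identityʳ _)
  ev-+ (a ∷ f) (b ∷ g) = begin
    φ (a R.+ b) + z * ev (f +ₚ g)        ≈⟨ +-cong (+-homo a b) (*-congˡ (ev-+ f g)) ⟩
    (φ a + φ b) + z * (ev f + ev g)
      ≈⟨ solve 5 (λ a b z f g → (a :+ b) :+ z :* (f :+ g) := (a :+ z :* f) :+ (b :+ z :* g))
           refl (φ a) (φ b) z (ev f) (ev g) ⟩
    (φ a + z * ev f) + (φ b + z * ev g)  ∎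

  ev-neg : ∀ f → ev (-ₚ f) ≈ - ev f
  ev-neg []      = sym -0#≈0#
  ev-neg (a ∷ f) = begin
    φ (R.- a) + z * ev (-ₚ f)  ≈⟨ +-cong (-‿homo a) (*-congˡ (ev-neg f)) ⟩
    - φ a + z * - ev f         ≈⟨ solve 3 (λ a z f → :- a :+ z :* (:- f) := :- (a :+ z :* f)) refl (φ a) z (ev f) ⟩
    - (φ a + z * ev f)         ∎

  ev-- : ∀ f g → ev (f -ₚ g) ≈ ev f - ev g
  ev-- f g = trans (ev-+ f (-ₚ g)) (+-congˡ (ev-neg g))

  ev-scale : ∀ a f → ev (List.map (a R.*_) f) ≈ φ a * ev f
  ev-scale a []      = sym (zeroʳ _)
  ev-scale a (b ∷ f) = begin
    φ (a R.* b) + z * ev (List.map (a R.*_) f)  ≈⟨ +-cong (*-homo a b) (*-congˡ (ev-scale a f)) ⟩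
    φ a * φ b + z * (φ a * ev f)
      ≈⟨ solve 4 (λ a b z f → a :* b :+ z :* (a :* f) := a :* (b :+ z :* f)) refl (φ a) (φ b) z (ev f) ⟩
    φ a * (φ b + z * ev f)                      ∎

  ev-shift : ∀ f → ev (R.0# ∷ f) ≈ z * ev f
  ev-shift f = trans (+-congʳ 0#-homo) (+-identityˡ _)

  ev-* : ∀ f g → ev (f *ₚ g) ≈ ev f * ev g
  ev-* []      g = sym (zeroˡ _)
  ev-* (a ∷ f) g = begin
    ev (List.map (a R.*_) g +ₚ (R.0# ∷ f *ₚ g))       ≈⟨ ev-+ (List.map (a R.*_) g) _ ⟩
    ev (List.map (a R.*_) g) + ev (R.0# ∷ f *ₚ g)     ≈⟨ +-cong (ev-scale a g) (trans (ev-shift (f *ₚ g)) (*-congˡ (ev-* f g))) ⟩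
    φ a * ev g + z * (ev f * ev g)
      ≈⟨ solve 4 (λ a z f g → a :* g :+ z :* (f :* g) := (a :+ z :* f) :* g) refl (φ a) z (ev f) (ev g) ⟩
    (φ a + z * ev f) * ev g                       ∎

  ev-C : ∀ a → ev (C a) ≈ φ a
  ev-C a = trans (+-congˡ (zeroʳ z)) (+-identityʳ _)

  ev-X : ev X ≈ z
  ev-X = trans (ev-shift (C R.1#)) (trans (*-congˡ (trans (ev-C R.1#) 1#-homo)) (*-identityʳ z))

  ev-X-C : ∀ a → ev (X -ₚ C a) ≈ z - φ a
  ev-X-C a = trans (ev-- X (C a)) (+-cong ev-X (-‿cong (ev-C a)))

  ev-sum : ∀ {n} (f : Fin n → Poly) → ev (sumₚ f) ≈ sum (ev ∘ f)
  ev-sum {zero}  f = refl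
  ev-sum {suc n} f = trans (ev-+ (f zero) (sumₚ (f ∘ suc))) (+-congˡ (ev-sum (f ∘ suc)))

  ev-^ : ∀ f {w} → ev f ≈ w → ∀ n → ev (f ^ₚ n) ≈ w ^ n
  ev-^ f f≈w zero    = trans (ev-C R.1#) 1#-homo
  ev-^ f f≈w (suc n) = trans (ev-* f (f ^ₚ n)) (*-cong f≈w (ev-^ f f≈w n))

  ev-root-product : ∀ {n} (r : Fin n → R.Carrier) →
    ev (productₚ (λ i → X -ₚ C (r i))) ≈ product (λ i → z - φ (r i))
  ev-root-product {zero}  r = trans (ev-C R.1#) 1#-homo
  ev-root-product {suc n} r =
    trans (ev-* (X -ₚ C (r zero)) (productₚ (λ i → X -ₚ C (r (suc i)))))
      (*-cong (ev-X-C (r zero)) (ev-root-product (r ∘ suc)))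

module CubicEvaluation {c ℓ₁ ℓ₂} (𝓡 : CompleteOrderedField c ℓ₁ ℓ₂) (S : CommutativeRing c ℓ₁)
  {φ : CompleteOrderedField.Carrier 𝓡 → CommutativeRing.Carrier S}
  (φ-isHom : RingMorphisms.IsRingHomomorphism (CompleteOrderedField.rawRing 𝓡) (CommutativeRing.rawRing S) φ)
  (z : CommutativeRing.Carrier S) where

  private module ℝ = CompleteOrderedField 𝓡
  open CommutativeRing S hiding (zero)
  open RingMorphisms.IsRingHomomorphism φ-isHom
  open RealPolynomial 𝓡 using (cubicAt; C; X; _-ₚ_; _*ₚ_; _^ₚ_)
  open Evaluation (CompleteOrderedField.commutativeRing 𝓡) S φ-isHom z
  open SemiringSum semiring using (sum-cong-≋)
  open IntegerSolver S

  ev-cubicAt : ∀ r a → ev (cubicAt r a) ≈ cubic S (φ ∘ a) (z - φ r)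
  ev-cubicAt r a = trans (ev-sum (λ i → C (a i) *ₚ (X -ₚ C r) ^ₚ toℕ i))
    (trans (sum-cong-≋ {4} λ i → trans (ev-* (C (a i)) ((X -ₚ C r) ^ₚ toℕ i))
                                   (*-cong (ev-C (a i)) (ev-^ (X -ₚ C r) (ev-X-C r) (toℕ i))))
      (solve 5 (λ a₀ a₁ a₂ a₃ w →
        a₀ :* con (+ 1) :+ (a₁ :* (w :* con (+ 1)) :+ (a₂ :* (w :* (w :* con (+ 1)))
          :+ (a₃ :* (w :* (w :* (w :* con (+ 1)))) :+ con (+ 0)))) :=
        a₀ :+ a₁ :* w :+ a₂ :* (w :* w) :+ a₃ :* (w :* w :* w))
        refl (φ (a 0F)) (φ (a 1F)) (φ (a 2F)) (φ (a 3F)) (z - φ r)))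

  cubic-congʳ : ∀ a {v w} → v ≈ w → cubic S a v ≈ cubic S a w
  cubic-congʳ a v≈w = +-cong (+-cong (+-congˡ (*-congˡ v≈w)) (*-congˡ (*-cong v≈w v≈w)))
    (*-congˡ (*-cong (*-cong v≈w v≈w) v≈w))

  cubic-scale : ∀ b a w → cubic S (λ i → φ (b ℝ.* a i)) w ≈ φ b * cubic S (φ ∘ a) w
  cubic-scale b a w = trans
    (+-cong (+-cong (+-cong (*-homo b (a 0F)) (*-congʳ (*-homo b (a 1F)))) (*-congʳ (*-homo b (a 2F)))) (*-congʳ (*-homo b (a 3F))))
    (solve 6 (λ b a₀ a₁ a₂ a₃ y →
      b :* a₀ :+ b :* a₁ :* y :+ b :* a₂ :* (y :* y) :+ b :* a₃ :* (y :* y :* y) :=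
      b :* (a₀ :+ a₁ :* y :+ a₂ :* (y :* y) :+ a₃ :* (y :* y :* y)))
      refl (φ b) (φ (a 0F)) (φ (a 1F)) (φ (a 2F)) (φ (a 3F)) w)

  ev-*-cubicAt : ∀ h {ρ r} a → r ℝ.≈ ρ → ev (h *ₚ cubicAt ρ a) ≈ ev h * cubic S (φ ∘ a) (z - φ r)
  ev-*-cubicAt h {ρ} {r} a r≈ρ = trans (ev-* h (cubicAt ρ a))
    (*-congˡ (trans (ev-cubicAt ρ a) (cubic-congʳ (φ ∘ a) (+-congˡ (-‿cong (⟦⟧-cong (ℝ.sym r≈ρ)))))))

-- Derivatives by evaluation at dual numbers

module DualNumbers {c ℓ} (R S : CommutativeRing c ℓ)
  {φ : CommutativeRing.Carrier R → CommutativeRing.Carrier S}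
  (φ-isHom : RingMorphisms.IsRingHomomorphism (CommutativeRing.rawRing R) (CommutativeRing.rawRing S) φ)
  where

  private module S = CommutativeRing S
  open QuadraticExtension S S.0# public using () renaming (adjoin to dual)
  open QuadraticExtension S S.0# using (embed-isRingHomomorphism)
  private module D = CommutativeRing dual
  open Polynomial (CommutativeRing.rawRing R)

  φ+ε0-isHom : RingMorphisms.IsRingHomomorphism (CommutativeRing.rawRing R) D.rawRing (λ a → φ a , S.0#)
  φ+ε0-isHom = Composition.isRingHomomorphism D.trans φ-isHom embed-isRingHomomorphism

  module _ (z : S.Carrier) where
    open Evaluation R S φ-isHom z
    private module Dual = Evaluation R dual φ+ε0-isHom (z , S.1#)

    -- Evaluation at z + ε computes the value together with the derivative.
    ev-dual : ∀ f → Dual.ev f D.≈ (ev f , ev (derivative f))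
    ev-dual []      = S.refl , S.refl
    ev-dual (a ∷ f) with ev-dual f
    ... | p , p′ =
      S.+-congˡ (S.trans (S.+-cong (S.*-congˡ p) (S.zeroˡ _)) (S.+-identityʳ _)) ,
      (begin
        S.0# S.+ (z S.* proj₂ (Dual.ev f) S.+ S.1# S.* proj₁ (Dual.ev f))
          ≈⟨ S.+-congˡ (S.+-cong (S.*-congˡ p′) (S.*-congˡ p)) ⟩
        S.0# S.+ (z S.* ev (derivative f) S.+ S.1# S.* ev f)
          ≈⟨ solve 3 (λ z d f → con (+ 0) :+ (z :* d :+ con (+ 1) :* f) := f :+ z :* d) S.refl z (ev (derivative f)) (ev f) ⟩
        ev f S.+ z S.* ev (derivative f)
          ≈⟨ S.+-congˡ (ev-shift (derivative f)) ⟨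
        ev f S.+ ev (CommutativeRing.0# R ∷ derivative f)
          ≈⟨ ev-+ f _ ⟨
        ev (derivative (a ∷ f)) ∎)
      where
      open SetoidReasoning S.setoid
      open IntegerSolver S

-- Products with one factor omitted

module OmittedProducts {c ℓ} (S : CommutativeRing c ℓ) where
  open CommutativeRing S hiding (zero)
  open RawSemiringDefinitions (Semiring.rawSemiring semiring) using (sum; product)
  private module Product = CommutativeMonoidSum *-commutativeMonoid
  open SemiringSum semiring using (*-distribˡ-sum; sum-cong-≋)
  open IntegerSolver S
  open SetoidReasoning setoid

  omit : ∀ {n} → (Fin (suc n) → Carrier) → Fin (suc n) → Carrier
  omit w k = product (removeAt w k)

  product-omit : ∀ {n} (w : Fin (suc n) → Carrier) k → product w ≈ w k * omit w k
  product-omit w k = Product.sum-remove {i = k} w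

  -- Since `j k` inverts `ω k`, each omitted product is `j k * product ω`. The square of the full
  -- product comes out of the sum, and the cubic is left divided by the square of its argument. The
  -- inverses are passed in, so that explicit conjugates can be used for them.
  sum-cubic-omit² : ∀ {m} (ω j : Fin (suc m) → Carrier) (a : Fin (suc m) → Fin 4 → Carrier) →
    (∀ k → ω k * j k ≈ 1#) →
    sum (λ k → cubic S (a k) (ω k) * (omit ω k * omit ω k)) ≈
      product ω * product ω * sum (λ k → reciprocalCubic S (a k) (ω k) (j k))
  sum-cubic-omit² {m} ω j a ωj≈1 = trans (sum-cong-≋ {suc m} term)
    (sym (*-distribˡ-sum (product ω * product ω)
      (λ k → reciprocalCubic S (a k) (ω k) (j k))))
    where
    omit≈j∏ : ∀ k → omit ω k ≈ j k * product ω
    omit≈j∏ k = begin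
      omit ω k                ≈⟨ *-identityˡ _ ⟨
      1# * omit ω k           ≈⟨ *-congʳ (ωj≈1 k) ⟨
      ω k * j k * omit ω k    ≈⟨ solve 3 (λ w j o → w :* j :* o := j :* (w :* o)) refl (ω k) (j k) (omit ω k) ⟩
      j k * (ω k * omit ω k)  ≈⟨ *-congˡ (product-omit ω k) ⟨
      j k * product ω         ∎

    term : ∀ k → cubic S (a k) (ω k) * (omit ω k * omit ω k) ≈
      product ω * product ω * reciprocalCubic S (a k) (ω k) (j k)
    term k = begin
      cubic S (a k) (ω k) * (omit ω k * omit ω k)
        ≈⟨ *-congˡ (*-cong (omit≈j∏ k) (omit≈j∏ k)) ⟩
      cubic S (a k) (ω k) * (j k * product ω * (j k * product ω))
        -- The products are grouped so that each factor `w * j` stands alone, ready to be replaced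
        -- by 1 in the next step.
        ≈⟨ solve 7 (λ a₀ a₁ a₂ a₃ w j p →
             (a₀ :+ a₁ :* w :+ a₂ :* (w :* w) :+ a₃ :* (w :* w :* w)) :* (j :* p :* (j :* p)) :=
             p :* p :* (a₀ :* (j :* j) :+ a₁ :* ((w :* j) :* j) :+ a₂ :* ((w :* j) :* (w :* j))
               :+ a₃ :* (w :* ((w :* j) :* (w :* j)))))
             refl (a k 0F) (a k 1F) (a k 2F) (a k 3F) (ω k) (j k) (product ω) ⟩
      product ω * product ω * (a k 0F * (j k * j k) + a k 1F * ((ω k * j k) * j k) + a k 2F * ((ω k * j k) * (ω k * j k))
        + a k 3F * (ω k * ((ω k * j k) * (ω k * j k))))
        ≈⟨ *-congˡ (+-cong (+-cong (+-congˡ (*-congˡ (trans (*-congʳ (ωj≈1 k)) (*-identityˡ _))))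
             (trans (*-congˡ (trans (*-cong (ωj≈1 k) (ωj≈1 k)) (*-identityˡ 1#))) (*-identityʳ _)))
             (*-congˡ (trans (*-congˡ (trans (*-cong (ωj≈1 k) (ωj≈1 k)) (*-identityˡ 1#))) (*-identityʳ _)))) ⟩
      product ω * product ω * reciprocalCubic S (a k) (ω k) (j k) ∎

-- Fields with decidable equality and ordered fields

module DiscreteField {c ℓ} (R : CommutativeRing c ℓ)
  (0≉1 : ¬ CommutativeRing._≈_ R (CommutativeRing.0# R) (CommutativeRing.1# R))
  (inverse : ∀ x → ¬ CommutativeRing._≈_ R x (CommutativeRing.0# R) →
    ∃ λ y → CommutativeRing._≈_ R (CommutativeRing._*_ R x y) (CommutativeRing.1# R))
  (_≟_ : Decidable (CommutativeRing._≈_ R)) where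

  open CommutativeRing R hiding (zero)
  open IntegerSolver R
  open RawSemiringDefinitions (Semiring.rawSemiring semiring) using (product)
  open SetoidReasoning setoid

  x≉0∧xy≈0⇒y≈0 : ∀ {x y} → x ≉ 0# → x * y ≈ 0# → y ≈ 0#
  x≉0∧xy≈0⇒y≈0 {x} {y} x≉0 xy≈0 with inverse x x≉0
  ... | x⁻¹ , xx⁻¹≈1 = begin
    y              ≈⟨ *-identityˡ y ⟨
    1# * y         ≈⟨ *-congʳ xx⁻¹≈1 ⟨
    x * x⁻¹ * y    ≈⟨ solve 3 (λ x i y → x :* i :* y := i :* (x :* y)) refl x x⁻¹ y ⟩
    x⁻¹ * (x * y)  ≈⟨ *-congˡ xy≈0 ⟩
    x⁻¹ * 0#       ≈⟨ zeroʳ x⁻¹ ⟩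
    0#             ∎

  *-≉0 : ∀ {x y} → x ≉ 0# → y ≉ 0# → x * y ≉ 0#
  *-≉0 x≉0 y≉0 xy≈0 = y≉0 (x≉0∧xy≈0⇒y≈0 x≉0 xy≈0)

  product≈0⇒factor≈0 : ∀ {n} (w : Fin n → Carrier) → product w ≈ 0# → ∃ λ k → w k ≈ 0#
  product≈0⇒factor≈0 {zero}  w 1≈0 = contradiction (sym 1≈0) 0≉1
  product≈0⇒factor≈0 {suc n} w p≈0 with w zero ≟ 0#
  ... | yes w₀≈0 = zero , w₀≈0
  ... | no  w₀≉0 with product≈0⇒factor≈0 (w ∘ suc) (x≉0∧xy≈0⇒y≈0 w₀≉0 p≈0)
  ...   | k , wₖ≈0 = suc k , wₖ≈0

module OrderedField {c ℓ₁ ℓ₂} (𝓡 : CompleteOrderedField c ℓ₁ ℓ₂) where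
  open CompleteOrderedField 𝓡 public hiding (zero)
  open IsDecTotalOrder isDecTotalOrder public
    using (_≟_; antisym; total; ≤-respˡ-≈; ≤-respʳ-≈)
    renaming (refl to ≤-refl; trans to ≤-trans; reflexive to ≤-reflexive)
  open IntegerSolver commutativeRing public
  open DiscreteField commutativeRing 0≉1 inverse _≟_ public
  open RingProperties ring using (-0#≈0#; -‿involutive)
  open RealPolynomial 𝓡 using (SameSign)
  open RawSemiringDefinitions (Semiring.rawSemiring semiring) public using (sum; product)

  x≤y⇒0≤y-x : ∀ {x y} → x ≤ y → 0# ≤ y - x
  x≤y⇒0≤y-x {x} {y} x≤y =
    ≤-respˡ-≈ (-‿inverseˡ x) (≤-respʳ-≈ (+-comm (- x) y) (+-monoʳ-≤ (- x) x≤y))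

  0≤y-x⇒x≤y : ∀ {x y} → 0# ≤ y - x → x ≤ y
  0≤y-x⇒x≤y {x} {y} 0≤y-x =
    ≤-respˡ-≈ (+-identityʳ x)
      (≤-respʳ-≈ (solve 2 (λ x y → x :+ (y :- x) := y) refl x y) (+-monoʳ-≤ x 0≤y-x))

  0<y-x⇒x<y : ∀ {x y} → 0# < y - x → x < y
  0<y-x⇒x<y {x} {y} (0≤y-x , 0≉y-x) = 0≤y-x⇒x≤y 0≤y-x ,
    λ x≈y → 0≉y-x (sym (trans (+-congʳ (sym x≈y)) (-‿inverseʳ x)))

  neg-nonneg : ∀ {x} → x ≤ 0# → 0# ≤ - x
  neg-nonneg x≤0 = ≤-respʳ-≈ (+-identityˡ _) (x≤y⇒0≤y-x x≤0)

  neg-nonneg⁻¹ : ∀ {x} → 0# ≤ - x → x ≤ 0#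
  neg-nonneg⁻¹ 0≤-x = 0≤y-x⇒x≤y (≤-respʳ-≈ (sym (+-identityˡ _)) 0≤-x)

  +-nonneg : ∀ {x y} → 0# ≤ x → 0# ≤ y → 0# ≤ x + y
  +-nonneg {x} 0≤x 0≤y = ≤-trans 0≤x (≤-respˡ-≈ (+-identityʳ x) (+-monoʳ-≤ x 0≤y))

  square-nonneg : ∀ x → 0# ≤ x * x
  square-nonneg x with total 0# x
  ... | inj₁ 0≤x = *-nonNeg 0≤x 0≤x
  ... | inj₂ x≤0 = ≤-respʳ-≈ (solve 1 (λ x → (:- x) :* (:- x) := x :* x) refl x)
                     (*-nonNeg (neg-nonneg x≤0) (neg-nonneg x≤0))

  0≤1 : 0# ≤ 1#
  0≤1 = ≤-respʳ-≈ (*-identityˡ 1#) (square-nonneg 1#)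

  0<1 : 0# < 1#
  0<1 = 0≤1 , 0≉1

  pos⇒≉0 : ∀ {x} → 0# < x → x ≉ 0#
  pos⇒≉0 (_ , 0≉x) x≈0 = 0≉x (sym x≈0)

  <-respʳ : ∀ {x y z} → y ≈ z → x < y → x < z
  <-respʳ y≈z (x≤y , x≉y) = ≤-respʳ-≈ y≈z x≤y , λ x≈z → x≉y (trans x≈z (sym y≈z))

  *-pos : ∀ {x y} → 0# < x → 0# < y → 0# < x * y
  *-pos 0<x 0<y = *-nonNeg (proj₁ 0<x) (proj₁ 0<y) , λ 0≈xy → *-≉0 (pos⇒≉0 0<x) (pos⇒≉0 0<y) (sym 0≈xy)

  x+y≈0⇒x≈0 : ∀ {x y} → 0# ≤ x → 0# ≤ y → x + y ≈ 0# → x ≈ 0#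
  x+y≈0⇒x≈0 {x} {y} 0≤x 0≤y x+y≈0 =
    antisym (≤-respˡ-≈ (+-identityʳ x) (≤-respʳ-≈ x+y≈0 (+-monoʳ-≤ x 0≤y))) 0≤x

  x+y≈0⇒y≈0 : ∀ {x y} → 0# ≤ x → 0# ≤ y → x + y ≈ 0# → y ≈ 0#
  x+y≈0⇒y≈0 {x} {y} 0≤x 0≤y x+y≈0 = x+y≈0⇒x≈0 0≤y 0≤x (trans (+-comm y x) x+y≈0)

  pos+nonneg : ∀ {x y} → 0# < x → 0# ≤ y → 0# < x + y
  pos+nonneg 0<x 0≤y = +-nonneg (proj₁ 0<x) 0≤y ,
    λ 0≈x+y → pos⇒≉0 0<x (x+y≈0⇒x≈0 (proj₁ 0<x) 0≤y (sym 0≈x+y))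

  nonneg+pos : ∀ {x y} → 0# ≤ x → 0# < y → 0# < x + y
  nonneg+pos {x} {y} 0≤x 0<y = <-respʳ (+-comm y x) (pos+nonneg 0<y 0≤x)

  pos-or-nonpos : ∀ x → 0# < x ⊎ x ≤ 0#
  pos-or-nonpos x with x ≟ 0# | total 0# x
  ... | yes x≈0 | _        = inj₂ (≤-reflexive x≈0)
  ... | no  x≉0 | inj₁ 0≤x = inj₁ (0≤x , λ 0≈x → x≉0 (sym 0≈x))
  ... | no  x≉0 | inj₂ x≤0 = inj₂ x≤0

  <⇒≱ : ∀ {x y} → x < y → ¬ (y ≤ x)
  <⇒≱ (x≤y , x≉y) y≤x = x≉y (antisym x≤y y≤x)

  inverse-pos : ∀ {x} → 0# < x → ∃ λ y → 0# < y × x * y ≈ 1#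
  inverse-pos {x} 0<x with inverse x (pos⇒≉0 0<x)
  ... | y , xy≈1 with pos-or-nonpos y
  ...   | inj₁ 0<y = y , 0<y , xy≈1
  ...   | inj₂ y≤0 = ⊥-elim (<⇒≱ 0<1 (neg-nonneg⁻¹
          (≤-respʳ-≈ (trans (solve 2 (λ x y → x :* (:- y) := :- (x :* y)) refl x y) (-‿cong xy≈1))
            (*-nonNeg (proj₁ 0<x) (neg-nonneg y≤0)))))

  cancel-pos : ∀ {x y} → 0# < x → 0# ≤ x * y → 0# ≤ y
  cancel-pos {x} {y} 0<x 0≤xy with inverse-pos 0<x
  ... | x⁻¹ , 0<x⁻¹ , xx⁻¹≈1 = ≤-respʳ-≈
    (trans (solve 3 (λ x i y → i :* (x :* y) := (x :* i) :* y) refl x x⁻¹ y)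
      (trans (*-congʳ xx⁻¹≈1) (*-identityˡ y)))
    (*-nonNeg (proj₁ 0<x⁻¹) 0≤xy)

  sum-nonneg : ∀ {n} (f : Fin n → Carrier) → (∀ k → 0# ≤ f k) → 0# ≤ sum f
  sum-nonneg {zero}  f 0≤f = ≤-refl
  sum-nonneg {suc n} f 0≤f = +-nonneg (0≤f zero) (sum-nonneg (f ∘ suc) (0≤f ∘ suc))

  sum≈0⇒term≈0 : ∀ {n} (f : Fin n → Carrier) → (∀ k → 0# ≤ f k) → sum f ≈ 0# → ∀ k → f k ≈ 0#
  sum≈0⇒term≈0 f 0≤f Σf≈0 zero    = x+y≈0⇒x≈0 (0≤f zero) (sum-nonneg (f ∘ suc) (0≤f ∘ suc)) Σf≈0
  sum≈0⇒term≈0 f 0≤f Σf≈0 (suc k) = sum≈0⇒term≈0 (f ∘ suc) (0≤f ∘ suc)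
    (x+y≈0⇒y≈0 (0≤f zero) (sum-nonneg (f ∘ suc) (0≤f ∘ suc)) Σf≈0) k

  -- The multiplier is 1 or -1. It merges the two cases of `SameSign`, so that every later sign
  -- argument is made once, for nonnegative quantities.
  sameSign⇒scaled-nonneg : ∀ {ℓ} {S : Pred Carrier ℓ} → SameSign S →
    ∃ λ ε → ε ≉ 0# × (∀ {y} → y ∈ S → 0# ≤ ε * y)
  sameSign⇒scaled-nonneg (inj₁ S≥0) = 1# , (λ 1≈0 → 0≉1 (sym 1≈0)) ,
    λ y∈S → ≤-respʳ-≈ (sym (*-identityˡ _)) (S≥0 y∈S)
  sameSign⇒scaled-nonneg (inj₂ S≤0) = - 1# ,
    (λ -1≈0 → 0≉1 (sym (trans (sym (-‿involutive 1#)) (trans (-‿cong -1≈0) -0#≈0#)))) ,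
    λ {y} y∈S → ≤-respʳ-≈ (solve 1 (λ y → :- y := (:- con (+ 1)) :* y) refl y) (neg-nonneg (S≤0 y∈S))

  -- The weights are (s - y) / (x - y) and (x - s) / (x - y), provided that x and y differ.
  convex-combination : ∀ {x y s} → y ≤ s → s ≤ x →
    ∃₂ λ α β → 0# ≤ α × 0# ≤ β × α + β ≈ 1# × α * x + β * y ≈ s
  convex-combination {x} {y} {s} y≤s s≤x with pos-or-nonpos (x - y)
  -- Here x ≤ y, so x, y and s coincide and division is impossible; this is the case of repeated
  -- zeros.
  ... | inj₂ x-y≤0 = 1# , 0# , 0≤1 , ≤-refl , +-identityʳ 1# ,
        trans (solve 2 (λ x y → con (+ 1) :* x :+ con (+ 0) :* y := x) refl x y)
          (antisym (≤-trans x≤y y≤s) s≤x)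
    where
    x≤y : x ≤ y
    x≤y = 0≤y-x⇒x≤y (≤-respʳ-≈ (solve 2 (λ x y → :- (x :- y) := y :- x) refl x y) (neg-nonneg x-y≤0))
  ... | inj₁ 0<x-y with inverse-pos 0<x-y
  ...   | i , 0<i , [x-y]i≈1 =
        (s - y) * i , (x - s) * i ,
        *-nonNeg (x≤y⇒0≤y-x y≤s) (proj₁ 0<i) , *-nonNeg (x≤y⇒0≤y-x s≤x) (proj₁ 0<i) ,
        trans (solve 4 (λ x y s i → (s :- y) :* i :+ (x :- s) :* i := (x :- y) :* i) refl x y s i) [x-y]i≈1 ,
        trans (solve 4 (λ x y s i → (s :- y) :* i :* x :+ (x :- s) :* i :* y := s :* ((x :- y) :* i)) refl x y s i)
          (trans (*-congˡ [x-y]i≈1) (*-identityʳ s))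

-- Interlacing zeros and nonnegative partial fractions

module Interlacing {c ℓ₁ ℓ₂} (𝓡 : CompleteOrderedField c ℓ₁ ℓ₂) (S : CommutativeRing c ℓ₁)
  {φ : CompleteOrderedField.Carrier 𝓡 → CommutativeRing.Carrier S}
  (φ-isHom : RingMorphisms.IsRingHomomorphism (CompleteOrderedField.rawRing 𝓡) (CommutativeRing.rawRing S) φ)
  where

  private module ℝ = OrderedField 𝓡
  open RealPolynomial 𝓡
    using (Decreasing; NonnegativeCoefficients; AllZeros; coeff; _≈ₚ_; C; X; _-ₚ_; _*ₚ_; productₚ)
  open CommutativeRing S hiding (zero)
  open RingMorphisms.IsRingHomomorphism φ-isHom
  open RawSemiringDefinitions (Semiring.rawSemiring semiring) using (sum; product)
  open SemiringSum semiring using (*-distribˡ-sum; *-distribʳ-sum; ∑-distrib-+; sum-cong-≋)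
  open OmittedProducts S
  open IntegerSolver S
  open SetoidReasoning setoid

  φ-sum : ∀ {n} (f : Fin n → ℝ.Carrier) → φ (ℝ.sum f) ≈ sum (φ ∘ f)
  φ-sum {zero}  f = 0#-homo
  φ-sum {suc n} f = trans (+-homo _ _) (+-congˡ (φ-sum (f ∘ suc)))

  -- By induction the factors after the first expand in omitted products of the tail of `r`. In the
  -- k-th summand z - s₀ is written as a convex combination of z - r₀ and z - r_{k+1}. The first
  -- part turns an omitted product of the tail into one of the whole list. The second restores the
  -- full tail product, which is the product omitting r₀. Nothing is divided by a difference of
  -- distinct zeros, so multiplicities cause no trouble.
  interlacing-coefficients : ∀ m (r : Fin (suc m) → ℝ.Carrier) (s : Fin m → ℝ.Carrier) →
    Decreasing r → (∀ i → r (suc i) ℝ.≤ s i × s i ℝ.≤ r (inject₁ i)) →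
    ∃ λ (b : Fin (suc m) → ℝ.Carrier) → (∀ k → ℝ.0# ℝ.≤ b k) ×
      (∀ z → product (λ i → z - φ (s i)) ≈ sum (λ k → φ (b k) * omit (λ i → z - φ (r i)) k))
  interlacing-coefficients zero    r s r↘ r≤s≤r = (λ _ → ℝ.1#) , (λ _ → ℝ.0≤1) ,
    λ z → sym (trans (+-identityʳ _) (trans (*-identityʳ _) 1#-homo))
  interlacing-coefficients (suc m) r s r↘ r≤s≤r
    with interlacing-coefficients m (r ∘ suc) (s ∘ suc) (λ i j i≤j → r↘ (suc i) (suc j) (s≤s i≤j)) (r≤s≤r ∘ suc)
  ... | b , 0≤b , ∏≈Σ = b′ , 0≤b′ , expand
    where
    split : ∀ k → ∃₂ λ α β → ℝ.0# ℝ.≤ α × ℝ.0# ℝ.≤ β × α ℝ.+ β ℝ.≈ ℝ.1# ×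
                             α ℝ.* r zero ℝ.+ β ℝ.* r (suc k) ℝ.≈ s zero
    -- By monotonicity r_{k+1} ≤ r_1 ≤ s_0 ≤ r_0, so `s zero` lies between `r zero` and every later
    -- zero, not just the next one.
    split k = ℝ.convex-combination
      (ℝ.≤-trans (r↘ (suc zero) (suc k) (s≤s z≤n)) (proj₁ (r≤s≤r zero))) (proj₂ (r≤s≤r zero))

    α β : Fin (suc m) → ℝ.Carrier
    α k = proj₁ (split k)
    β k = proj₁ (proj₂ (split k))

    b′ : Fin (suc (suc m)) → ℝ.Carrier
    b′ zero    = ℝ.sum (λ k → β k ℝ.* b k)
    b′ (suc k) = α k ℝ.* b k

    0≤b′ : ∀ k → ℝ.0# ℝ.≤ b′ k
    0≤b′ zero    = ℝ.sum-nonneg (λ k → β k ℝ.* b k) λ k → ℝ.*-nonNeg (proj₁ (proj₂ (proj₂ (proj₂ (split k))))) (0≤b k)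
    0≤b′ (suc k) = ℝ.*-nonNeg (proj₁ (proj₂ (proj₂ (split k)))) (0≤b k)

    module _ (z : Carrier) where
      w : Fin (suc (suc m)) → Carrier
      w i = z - φ (r i)

      split-factor : ∀ k → z - φ (s zero) ≈ φ (α k) * w zero + φ (β k) * w (suc k)
      split-factor k with split k
      ... | α , β , _ , _ , α+β≈1 , αr+βr≈s = sym (begin
        φ α * (z - φ (r zero)) + φ β * (z - φ (r (suc k)))
          ≈⟨ solve 5 (λ a b z x y → a :* (z :- x) :+ b :* (z :- y) := (a :+ b) :* z :- (a :* x :+ b :* y))
               refl (φ α) (φ β) z (φ (r zero)) (φ (r (suc k))) ⟩
        (φ α + φ β) * z - (φ α * φ (r zero) + φ β * φ (r (suc k)))
          ≈⟨ +-cong (*-congʳ (+-homo α β)) (-‿cong (+-cong (*-homo α _) (*-homo β _))) ⟨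
        φ (α ℝ.+ β) * z - (φ (α ℝ.* r zero) + φ (β ℝ.* r (suc k)))
          ≈⟨ +-cong (*-congʳ (trans (⟦⟧-cong α+β≈1) 1#-homo))
               (-‿cong (trans (sym (+-homo _ _)) (⟦⟧-cong αr+βr≈s))) ⟩
        1# * z - φ (s zero)
          ≈⟨ +-congʳ (*-identityˡ z) ⟩
        z - φ (s zero) ∎)

      split-term : ∀ k → (z - φ (s zero)) * (φ (b k) * omit (w ∘ suc) k) ≈
        φ (β k ℝ.* b k) * product (w ∘ suc) + φ (b′ (suc k)) * omit w (suc k)
      split-term k = begin
        (z - φ (s zero)) * (φ (b k) * Q)
          ≈⟨ *-congʳ (split-factor k) ⟩
        (φ (α k) * w zero + φ (β k) * w (suc k)) * (φ (b k) * Q)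
          ≈⟨ solve 6 (λ a b x y c q → (a :* x :+ b :* y) :* (c :* q) :=
               (b :* c) :* (y :* q) :+ (a :* c) :* (x :* q))
               refl (φ (α k)) (φ (β k)) (w zero) (w (suc k)) (φ (b k)) Q ⟩
        (φ (β k) * φ (b k)) * (w (suc k) * Q) + (φ (α k) * φ (b k)) * (w zero * Q)
          ≈⟨ +-cong (*-cong (*-homo _ _) (product-omit (w ∘ suc) k)) (*-congʳ (*-homo _ _)) ⟨
        φ (β k ℝ.* b k) * product (w ∘ suc) + φ (b′ (suc k)) * (w zero * Q) ∎
        where
        Q = omit (w ∘ suc) k

      expand : product (λ i → z - φ (s i)) ≈ sum (λ k → φ (b′ k) * omit w k)
      expand = begin
        (z - φ (s zero)) * product (λ i → z - φ (s (suc i)))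
          ≈⟨ *-congˡ (∏≈Σ z) ⟩
        (z - φ (s zero)) * sum (λ k → φ (b k) * omit (w ∘ suc) k)
          ≈⟨ *-distribˡ-sum (z - φ (s zero)) (λ k → φ (b k) * omit (w ∘ suc) k) ⟩
        sum (λ k → (z - φ (s zero)) * (φ (b k) * omit (w ∘ suc) k))
          ≈⟨ sum-cong-≋ {suc m} split-term ⟩
        sum (λ k → φ (β k ℝ.* b k) * product (w ∘ suc) + φ (b′ (suc k)) * omit w (suc k))
          ≈⟨ ∑-distrib-+ {suc m} (λ k → φ (β k ℝ.* b k) * product (w ∘ suc)) (λ k → φ (b′ (suc k)) * omit w (suc k)) ⟩
        sum (λ k → φ (β k ℝ.* b k) * product (w ∘ suc)) + sum (λ k → φ (b′ (suc k)) * omit w (suc k))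
          ≈⟨ +-congʳ (*-distribʳ-sum (product (w ∘ suc)) (λ k → φ (β k ℝ.* b k))) ⟨
        sum (λ k → φ (β k ℝ.* b k)) * product (w ∘ suc) + sum (λ k → φ (b′ (suc k)) * omit w (suc k))
          ≈⟨ +-congʳ (*-congʳ (φ-sum (λ k → β k ℝ.* b k))) ⟨
        φ (b′ zero) * product (w ∘ suc) + sum (λ k → φ (b′ (suc k)) * omit w (suc k)) ∎

  module _ (z : Carrier) where
    open Evaluation ℝ.commutativeRing S φ-isHom z

    ev-factored : ∀ f {n} (r : Fin n → ℝ.Carrier) → f ≈ₚ C (coeff f n) *ₚ productₚ (λ i → X -ₚ C (r i)) →
      ev f ≈ φ (coeff f n) * product (λ i → z - φ (r i))
    ev-factored f {n} r f≈ = trans (ev-cong f (C (coeff f n) *ₚ productₚ (λ i → X -ₚ C (r i))) f≈)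
      (trans (ev-* (C (coeff f n)) (productₚ (λ i → X -ₚ C (r i))))
        (*-cong (ev-C (coeff f n)) (ev-root-product r)))

  -- The leading coefficient of `f₀` is absorbed into the weights, which stay nonnegative because
  -- the coefficients of `f₀` are. The weights do not depend on `z`; over dual numbers the same
  -- expansion therefore also describes the derivative of `f₀`.
  interlacing⇒partial-fractions : ∀ f₀ {m} (r : Fin (suc m) → ℝ.Carrier) (s : Fin m → ℝ.Carrier) →
    NonnegativeCoefficients f₀ → AllZeros f₀ s →
    Decreasing r → (∀ i → r (suc i) ℝ.≤ s i × s i ℝ.≤ r (inject₁ i)) →
    ∃ λ (b : Fin (suc m) → ℝ.Carrier) → (∀ k → ℝ.0# ℝ.≤ b k) ×
      (∀ z → Evaluation.ev ℝ.commutativeRing S φ-isHom z f₀ ≈ sum (λ k → φ (b k) * omit (λ i → z - φ (r i)) k))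
  interlacing⇒partial-fractions f₀ {m} r s 0≤f₀ (_ , f₀≈) r↘ r≤s≤r
    with interlacing-coefficients m r s r↘ r≤s≤r
  ... | b , 0≤b , ∏≈Σ = (λ k → d ℝ.* b k) , (λ k → ℝ.*-nonNeg (0≤f₀ m) (0≤b k)) , λ z →
    trans (ev-factored z f₀ s f₀≈) (trans (*-congˡ (∏≈Σ z))
      (trans (*-distribˡ-sum (φ d) (λ k → φ (b k) * omit (λ i → z - φ (r i)) k))
        (sum-cong-≋ {suc m} λ k → trans (sym (*-assoc (φ d) (φ (b k)) (omit (λ i → z - φ (r i)) k)))
          (*-congʳ (sym (*-homo d (b k)))))))
    where
    d = coeff f₀ m

-- A Wronskian computed with dual numbers

module DualWronskian {c ℓ} (S : CommutativeRing c ℓ) where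
  open CommutativeRing S hiding (zero)
  open QuadraticExtension S 0# using (embed) renaming (adjoin to dual)
  private module D = CommutativeRing dual
  open RawSemiringDefinitions (Semiring.rawSemiring semiring) using (sum; product)
  open RawSemiringDefinitions (Semiring.rawSemiring D.semiring) using () renaming (sum to sumᴰ; product to productᴰ)
  open OmittedProducts S
  open OmittedProducts dual using () renaming (omit to omitᴰ; product-omit to product-omitᴰ)
  open SemiringSum semiring using (*-distribˡ-sum; sum-cong-≋)
  open IntegerSolver S
  open SetoidReasoning setoid

  product-re : ∀ {n} (w : Fin n → D.Carrier) → proj₁ (productᴰ w) ≈ product (proj₁ ∘ w)
  product-re {zero}  w = refl
  product-re {suc n} w = trans (+-congˡ (zeroˡ _)) (trans (+-identityʳ _) (*-congˡ (product-re (w ∘ suc))))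

  linear-sum : ∀ {n} x y (G : Fin n → D.Carrier) →
    x * proj₁ (sumᴰ G) + y * proj₂ (sumᴰ G) ≈ sum (λ k → x * proj₁ (G k) + y * proj₂ (G k))
  linear-sum {zero}  x y G = solve 2 (λ x y → x :* con (+ 0) :+ y :* con (+ 0) := con (+ 0)) refl x y
  linear-sum {suc n} x y G = trans
    (solve 6 (λ x y a b a′ b′ → x :* (a :+ a′) :+ y :* (b :+ b′) :=
                (x :* a :+ y :* b) :+ (x :* a′ :+ y :* b′)) refl x y _ _ _ _)
    (+-congˡ (linear-sum x y (G ∘ suc)))

  -- For fixed `F` the left side is linear in the two components of `G`, so it may be computed for
  -- one summand b Q of `G`. There F = e w Q with w′ = 1, and F G′ - F′ G = e b (w Q Q′ - (Q + w Q′)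
  -- Q) = -e b Q²: the derivative of Q drops out.
  wronskian-sum : ∀ {n} (w : Fin (suc n) → D.Carrier) → (∀ k → proj₂ (w k) ≈ 1#) →
    (let ω = proj₁ ∘ w) (e Δ q : Carrier) (b : Fin (suc n) → Carrier) (F G : D.Carrier) →
    F D.≈ embed e D.* productᴰ w →
    G D.≈ sumᴰ (λ k → embed (b k) D.* omitᴰ w k) →
    q * (proj₁ F * proj₂ G - proj₂ F * proj₁ G) - Δ * proj₁ F * proj₁ G ≈
    - e * sum (λ k → b k * ((ω k * Δ + q) * (omit ω k * omit ω k)))
  wronskian-sum w w′≈1 e Δ q b F G (F₀≈ , F₁≈) (G₀≈ , G₁≈) = begin
    q * (proj₁ F * proj₂ G - proj₂ F * proj₁ G) - Δ * proj₁ F * proj₁ G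
      ≈⟨ solve 6 (λ q d a b a′ b′ → q :* (a :* b′ :- b :* a′) :- d :* a :* a′ :=
           (:- (q :* b :+ d :* a)) :* a′ :+ (q :* a) :* b′) refl q Δ _ _ _ _ ⟩
    x * proj₁ G + y * proj₂ G
      ≈⟨ +-cong (*-congˡ G₀≈) (*-congˡ G₁≈) ⟩
    x * proj₁ (sumᴰ T) + y * proj₂ (sumᴰ T)
      ≈⟨ linear-sum x y T ⟩
    sum (λ k → x * proj₁ (T k) + y * proj₂ (T k))
      ≈⟨ sum-cong-≋ term ⟩
    sum (λ k → - e * (b k * ((ω k * Δ + q) * (omit ω k * omit ω k))))
      ≈⟨ *-distribˡ-sum (- e) (λ k → b k * ((ω k * Δ + q) * (omit ω k * omit ω k))) ⟨
    - e * sum (λ k → b k * ((ω k * Δ + q) * (omit ω k * omit ω k))) ∎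
    where
    x y : Carrier
    x = - (q * proj₂ F + Δ * proj₁ F)
    y = q * proj₁ F
    ω = proj₁ ∘ w
    T = λ k → embed (b k) D.* omitᴰ w k

    term : ∀ k → x * proj₁ (T k) + y * proj₂ (T k) ≈ - e * (b k * ((ω k * Δ + q) * (omit ω k * omit ω k)))
    term k with product-omitᴰ w k | product-re (w ∘ punchIn k)
    ... | ∏₀≈ , ∏₁≈ | Q₀≈ = begin
      - (q * proj₂ F + Δ * proj₁ F) * proj₁ (T k) + q * proj₁ F * proj₂ (T k)
        ≈⟨ +-cong (*-congʳ (-‿cong (+-cong (*-congˡ F₁≈′) (*-congˡ F₀≈′)))) (*-congʳ (*-congˡ F₀≈′)) ⟩
      -- The dual products are written out literally, with δ = 0 and derivative 1 of the linear
      -- factor, to match the unfolded terms. All terms in `Q′` cancel.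
      _ ≈⟨ solve 7 (λ e b d q o Q Q′ →
             (:- (q :* (e :* (o :* Q′ :+ con (+ 1) :* Q) :+ con (+ 0) :* (o :* Q :+ con (+ 0) :* (con (+ 1) :* Q′)))
               :+ d :* (e :* (o :* Q :+ con (+ 0) :* (con (+ 1) :* Q′))
                  :+ con (+ 0) :* (con (+ 0) :* (o :* Q′ :+ con (+ 1) :* Q)))))
               :* (b :* Q :+ con (+ 0) :* (con (+ 0) :* Q′))
             :+ q :* (e :* (o :* Q :+ con (+ 0) :* (con (+ 1) :* Q′))
                  :+ con (+ 0) :* (con (+ 0) :* (o :* Q′ :+ con (+ 1) :* Q)))
               :* (b :* Q′ :+ con (+ 0) :* Q) :=
             (:- e) :* (b :* ((o :* d :+ q) :* (Q :* Q))))
             refl e (b k) Δ q (ω k) Q₀ Q₁ ⟩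
      - e * (b k * ((ω k * Δ + q) * (Q₀ * Q₀)))
        ≈⟨ *-congˡ (*-congˡ (*-congˡ (*-cong Q₀≈ Q₀≈))) ⟩
      - e * (b k * ((ω k * Δ + q) * (omit ω k * omit ω k))) ∎
      where
      Q₀ = proj₁ (omitᴰ w k)
      Q₁ = proj₂ (omitᴰ w k)
      ∏₀≈′ = trans ∏₀≈ (+-congˡ (*-congˡ (*-congʳ (w′≈1 k))))
      ∏₁≈′ = trans ∏₁≈ (+-congˡ (*-congʳ (w′≈1 k)))
      F₀≈′ = trans F₀≈ (+-cong (*-congˡ ∏₀≈′) (*-congˡ (*-congˡ ∏₁≈′)))
      F₁≈′ = trans F₁≈ (+-cong (*-congˡ ∏₁≈′) (*-congˡ ∏₀≈′))

-- Real polynomials: bounds, sign changes and vanishing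

module RealEvaluation {c ℓ₁ ℓ₂} (𝓡 : CompleteOrderedField c ℓ₁ ℓ₂) where
  open OrderedField 𝓡
  open RealPolynomial 𝓡 using (eval; coeff; NonnegativeCoefficients)
  open SetoidReasoning setoid

  module EvaluateAt = Evaluation commutativeRing commutativeRing
    (Identity.isRingHomomorphism rawRing refl)

  module EvaluateCubicAt = CubicEvaluation 𝓡 commutativeRing (Identity.isRingHomomorphism rawRing refl)

  infix 4 ∣_∣≤_
  -- Two nonnegativities instead of an absolute value: bounds on sums and products then follow by
  -- adding and multiplying them.
  ∣_∣≤_ : Carrier → Carrier → Set ℓ₂
  ∣ x ∣≤ B = 0# ≤ B - x × 0# ≤ B + x

  bound-exists : ∀ x → ∃ λ B → ∣ x ∣≤ B
  bound-exists x with total 0# x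
  ... | inj₁ 0≤x = x , ≤-reflexive (sym (-‿inverseʳ x)) , +-nonneg 0≤x 0≤x
  ... | inj₂ x≤0 = - x , +-nonneg (neg-nonneg x≤0) (neg-nonneg x≤0) , ≤-reflexive (sym (-‿inverseˡ x))

  bound-nonneg : ∀ {x B} → ∣ x ∣≤ B → 0# ≤ B
  bound-nonneg {x} {B} (0≤B-x , 0≤B+x) with total 0# B
  ... | inj₁ 0≤B = 0≤B
  ... | inj₂ B≤0 = ≤-respʳ-≈ (solve 2 (λ x B → (B :- x) :+ (B :+ x) :+ :- B := B) refl x B)
                     (+-nonneg (+-nonneg 0≤B-x 0≤B+x) (neg-nonneg B≤0))

  halve-nonneg : ∀ {x} → 0# ≤ x + x → 0# ≤ x
  halve-nonneg {x} 0≤x+x with total 0# x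
  ... | inj₁ 0≤x = 0≤x
  ... | inj₂ x≤0 = ≤-respʳ-≈ (solve 1 (λ x → x :+ x :+ :- x := x) refl x) (+-nonneg 0≤x+x (neg-nonneg x≤0))

  bound-+ : ∀ {x y A B} → ∣ x ∣≤ A → ∣ y ∣≤ B → ∣ x + y ∣≤ A + B
  bound-+ {x} {y} {A} {B} (l , u) (l′ , u′) =
    ≤-respʳ-≈ (solve 4 (λ x y A B → (A :- x) :+ (B :- y) := (A :+ B) :- (x :+ y)) refl x y A B) (+-nonneg l l′) ,
    ≤-respʳ-≈ (solve 4 (λ x y A B → (A :+ x) :+ (B :+ y) := (A :+ B) :+ (x :+ y)) refl x y A B) (+-nonneg u u′)

  -- The identity (A - x)(B + y) + (A + x)(B - y) = 2 (AB - xy), and its variant for AB + xy, yield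
  -- twice the wanted quantity; hence `halve-nonneg`.
  bound-* : ∀ {x y A B} → ∣ x ∣≤ A → ∣ y ∣≤ B → ∣ x * y ∣≤ A * B
  bound-* {x} {y} {A} {B} (l , u) (l′ , u′) =
    halve-nonneg (≤-respʳ-≈
      (solve 4 (λ x y A B → (A :- x) :* (B :+ y) :+ (A :+ x) :* (B :- y) :=
        (A :* B :- x :* y) :+ (A :* B :- x :* y)) refl x y A B)
      (+-nonneg (*-nonNeg l u′) (*-nonNeg u l′))) ,
    halve-nonneg (≤-respʳ-≈
      (solve 4 (λ x y A B → (A :- x) :* (B :- y) :+ (A :+ x) :* (B :+ y) :=
        (A :* B :+ x :* y) :+ (A :* B :+ x :* y)) refl x y A B)
      (+-nonneg (*-nonNeg l l′) (*-nonNeg u u′)))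

  -- Quantitative continuity: the difference quotient `κ` is computed along Horner's scheme, and the
  -- bound `M` is uniform in the step `t`.
  locally-lipschitz : ∀ f x → ∃ λ M → ∀ t → ∣ t ∣≤ 1# →
    ∃ λ κ → eval f (x + t) ≈ eval f x + t * κ × ∣ κ ∣≤ M
  locally-lipschitz []      x = 0# , λ t _ → 0# ,
    solve 1 (λ t → con (+ 0) := con (+ 0) :+ t :* con (+ 0)) refl t ,
    ≤-reflexive (sym (-‿inverseʳ 0#)) , ≤-reflexive (sym (+-identityʳ 0#))
  locally-lipschitz (a ∷ f) x with locally-lipschitz f x | bound-exists (eval f x) | bound-exists x
  ... | M , slope | Bf , f≤Bf | Bx , x≤Bx = Bf + 1# * M + Bx * M , λ t ∣t∣≤1 →
    let κ , f[x+t]≈ , κ≤M = slope t ∣t∣≤1 in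
    eval f x + t * κ + x * κ ,
    (begin
      a + (x + t) * eval f (x + t)         ≈⟨ +-congˡ (*-congˡ f[x+t]≈) ⟩
      a + (x + t) * (eval f x + t * κ)
        ≈⟨ solve 5 (λ a x t f κ → a :+ (x :+ t) :* (f :+ t :* κ) :=
             (a :+ x :* f) :+ t :* (f :+ t :* κ :+ x :* κ)) refl a x t (eval f x) κ ⟩
      (a + x * eval f x) + t * (eval f x + t * κ + x * κ) ∎) ,
    bound-+ (bound-+ f≤Bf (bound-* ∣t∣≤1 κ≤M)) (bound-* x≤Bx κ≤M)

  minimum : ∀ {x y} → 0# < x → 0# < y → ∃ λ m → 0# < m × m ≤ x × m ≤ y
  minimum {x} {y} 0<x 0<y with total x y
  ... | inj₁ x≤y = x , 0<x , ≤-refl , x≤y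
  ... | inj₂ y≤x = y , 0<y , y≤x , ≤-refl

  -- The step is t = min(d, v, 1) / (M + 2). Then t (M + 2) is at most each of d, v and 1, and the
  -- two extra units leave the slack that makes d - t and v - t M strictly positive.
  small-step : ∀ {M d v} → 0# ≤ M → 0# < d → 0# < v →
    ∃ λ t → 0# < t × 0# ≤ 1# - t × 0# < d - t × 0# < v - t * M
  small-step {M} {d} {v} 0≤M 0<d 0<v
    with minimum 0<d 0<v | inverse-pos (nonneg+pos (+-nonneg 0≤M 0≤1) 0<1)
  ... | m , 0<m , m≤d , m≤v | i , 0<i , [M+2]i≈1 with minimum 0<m 0<1
  ...   | n , 0<n , n≤m , n≤1 = t , 0<t ,
    ≤-respʳ-≈ (solve 3 (λ a t M → (a :- t :* (M :+ con (+ 1) :+ con (+ 1))) :+ (t :* M :+ t) := a :- t) refl 1# t M)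
      (+-nonneg (below n≤1) (+-nonneg 0≤tM (proj₁ 0<t))) ,
    <-respʳ (solve 3 (λ a t M → (a :- t :* (M :+ con (+ 1) :+ con (+ 1))) :+ (t :* M :+ t) := a :- t) refl d t M)
      (nonneg+pos (below (≤-trans n≤m m≤d)) (nonneg+pos 0≤tM 0<t)) ,
    <-respʳ (solve 3 (λ a t M → (a :- t :* (M :+ con (+ 1) :+ con (+ 1))) :+ (t :+ t) := a :- t :* M) refl v t M)
      (nonneg+pos (below (≤-trans n≤m m≤v)) (pos+nonneg 0<t (proj₁ 0<t)))
    where
    t = n * i
    0<t : 0# < t
    0<t = *-pos 0<n 0<i
    0≤tM : 0# ≤ t * M
    0≤tM = *-nonNeg (proj₁ 0<t) 0≤M
    t[M+2]≈n : t * (M + 1# + 1#) ≈ n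
    t[M+2]≈n = trans (solve 3 (λ n i s → n :* i :* s := n :* (s :* i)) refl n i (M + 1# + 1#))
      (trans (*-congˡ [M+2]i≈1) (*-identityʳ n))
    below : ∀ {a} → n ≤ a → 0# ≤ a - t * (M + 1# + 1#)
    below n≤a = ≤-respʳ-≈ (+-congˡ (-‿cong (sym t[M+2]≈n))) (x≤y⇒0≤y-x n≤a)

  -- If g(x₀) were nonzero with sign σ = ±1, a short step to x = x₀ + σ t would keep the sign σ by
  -- the Lipschitz bound, while (x₀ - x) g(x) = -t σ g(x) would be negative. The bound `L` keeps the
  -- step inside the region where the hypothesis holds.
  sign-change⇒zero : ∀ g {L x₀} → L < x₀ → (∀ x → L < x → 0# ≤ (x₀ - x) * eval g x) → eval g x₀ ≈ 0#
  sign-change⇒zero g {L} {x₀} L<x₀ changes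
    with locally-lipschitz g x₀
  ... | M , slope = antisym
    (nonpos (not-positive 1# (solve 0 (con (+ 1) :* con (+ 1) := con (+ 1)) refl)
      (≤-reflexive (sym (-‿inverseʳ 1#)) , +-nonneg 0≤1 0≤1)) (*-identityˡ _))
    (≤-respʳ-≈ (solve 1 (λ g → :- (:- con (+ 1) :* g) := g) refl (eval g x₀))
      (neg-nonneg (nonpos (not-positive (- 1#) (solve 0 (:- con (+ 1) :* :- con (+ 1) := con (+ 1)) refl)
        (≤-respʳ-≈ (solve 0 (con (+ 1) :+ con (+ 1) := con (+ 1) :- :- con (+ 1)) refl) (+-nonneg 0≤1 0≤1) ,
         ≤-reflexive (sym (-‿inverseʳ 1#)))) refl)))
    where
    0<x₀-L : 0# < x₀ - L
    0<x₀-L = x≤y⇒0≤y-x (proj₁ L<x₀) , λ 0≈x₀-L → proj₂ L<x₀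
      (sym (trans (solve 2 (λ x L → x := (x :- L) :+ L) refl x₀ L) (trans (+-congʳ (sym 0≈x₀-L)) (+-identityˡ L))))

    nonpos : ∀ {x y} → ¬ (0# < x) → x ≈ y → y ≤ 0#
    nonpos {x} ¬0<x x≈y with pos-or-nonpos x
    ... | inj₁ 0<x = contradiction 0<x ¬0<x
    ... | inj₂ x≤0 = ≤-respˡ-≈ x≈y x≤0

    0≤M : 0# ≤ M
    -- The step 0 is chosen only to exhibit one slope bounded by `M`.
    0≤M = bound-nonneg (proj₂ (proj₂ (slope 0#
      (≤-respʳ-≈ (solve 0 (con (+ 1) := con (+ 1) :- con (+ 0)) refl) 0≤1 , ≤-respʳ-≈ (sym (+-identityʳ 1#)) 0≤1))))

    not-positive : ∀ σ → σ * σ ≈ 1# → ∣ σ ∣≤ 1# → ¬ (0# < σ * eval g x₀)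
    not-positive σ σσ≈1 (0≤1-σ , 0≤1+σ) 0<σg =
      let t , 0<t , 0≤1-t , 0<d-t , 0<σg-tM = small-step 0≤M 0<x₀-L 0<σg
          κ , g[x]≈ , _ , 0≤M+κ = slope (σ * t) (bounded 0<t 0≤1-t)
      in <⇒≱ (*-pos 0<t (0<σg+tκ 0<t 0<σg-tM 0≤M+κ))
           (neg-nonneg⁻¹ (≤-respʳ-≈ (rearrange g[x]≈) (changes (x₀ + σ * t) (L<x 0<t 0<d-t))))
      where
      bounded : ∀ {t} → 0# < t → 0# ≤ 1# - t → ∣ σ * t ∣≤ 1#
      bounded {t} 0<t 0≤1-t =
        ≤-respʳ-≈ (solve 3 (λ a s t → (a :- t) :+ t :* (con (+ 1) :- s) := a :- s :* t) refl 1# σ t)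
          (+-nonneg 0≤1-t (*-nonNeg (proj₁ 0<t) 0≤1-σ)) ,
        ≤-respʳ-≈ (solve 3 (λ a s t → (a :- t) :+ t :* (con (+ 1) :+ s) := a :+ s :* t) refl 1# σ t)
          (+-nonneg 0≤1-t (*-nonNeg (proj₁ 0<t) 0≤1+σ))

      rearrange : ∀ {t κ} → eval g (x₀ + σ * t) ≈ eval g x₀ + σ * t * κ →
        (x₀ - (x₀ + σ * t)) * eval g (x₀ + σ * t) ≈ - (t * (σ * eval g x₀ + t * κ))
      rearrange {t} {κ} g[x]≈ = begin
        (x₀ - (x₀ + σ * t)) * eval g (x₀ + σ * t)
          ≈⟨ *-congˡ g[x]≈ ⟩
        (x₀ - (x₀ + σ * t)) * (eval g x₀ + σ * t * κ)
          ≈⟨ solve 5 (λ x s t g κ → (x :- (x :+ s :* t)) :* (g :+ s :* t :* κ) :=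
               :- (t :* (s :* g :+ (s :* s) :* (t :* κ)))) refl x₀ σ t (eval g x₀) κ ⟩
        - (t * (σ * eval g x₀ + (σ * σ) * (t * κ)))
          ≈⟨ -‿cong (*-congˡ (+-congˡ (trans (*-congʳ σσ≈1) (*-identityˡ _)))) ⟩
        - (t * (σ * eval g x₀ + t * κ)) ∎

      0<σg+tκ : ∀ {t κ} → 0# < t → 0# < σ * eval g x₀ - t * M → 0# ≤ M + κ → 0# < σ * eval g x₀ + t * κ
      0<σg+tκ {t} {κ} 0<t 0<σg-tM 0≤M+κ =
        <-respʳ (solve 4 (λ v t M κ → (v :- t :* M) :+ t :* (M :+ κ) := v :+ t :* κ) refl (σ * eval g x₀) t M κ)
          (pos+nonneg 0<σg-tM (*-nonNeg (proj₁ 0<t) 0≤M+κ))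

      L<x : ∀ {t} → 0# < t → 0# < (x₀ - L) - t → L < x₀ + σ * t
      L<x {t} 0<t 0<d-t = 0<y-x⇒x<y (<-respʳ
        (solve 4 (λ x L s t → ((x :- L) :- t) :+ t :* (con (+ 1) :+ s) := (x :+ s :* t) :- L) refl x₀ L σ t)
        (pos+nonneg 0<d-t (*-nonNeg (proj₁ 0<t) 0≤1+σ)))

  vanishing⇒≈0 : ∀ f → (∀ x → eval f x ≈ 0#) → ∀ k → coeff f k ≈ 0#
  vanishing⇒≈0 []      f≈0 k = refl
  vanishing⇒≈0 (a ∷ f) f≈0 = λ where
      zero    → a≈0
      (suc k) → vanishing⇒≈0 f tail≈0 k
    where
    a≈0 : a ≈ 0#
    a≈0 = trans (sym (trans (+-congˡ (zeroˡ _)) (+-identityʳ a))) (f≈0 0#)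

    x*f≈0 : ∀ x → x * eval f x ≈ 0#
    x*f≈0 x = trans (sym (trans (+-congʳ a≈0) (+-identityˡ _))) (f≈0 x)

    tail≈0 : ∀ x → eval f x ≈ 0#
    tail≈0 x with x ≟ 0#
    ... | no x≉0  = x≉0∧xy≈0⇒y≈0 x≉0 (x*f≈0 x)
    -- Cancelling x fails at 0 itself. Since y f(y) vanishes for every y, the sign-change hypothesis
    -- holds trivially there, and the lemma acts as continuity of the tail.
    ... | yes x≈0 = sign-change⇒zero f {x - 1#}
      (0<y-x⇒x<y (<-respʳ (solve 2 (λ x a → a := x :- (x :- a)) refl x 1#) 0<1))
      λ y _ → ≤-reflexive (sym (begin
        (x - y) * eval f y        ≈⟨ *-congʳ (+-congʳ x≈0) ⟩
        (0# - y) * eval f y       ≈⟨ solve 2 (λ y f → (con (+ 0) :- y) :* f := :- (y :* f)) refl y (eval f y) ⟩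
        - (y * eval f y)          ≈⟨ -‿cong (x*f≈0 y) ⟩
        - 0#                      ≈⟨ solve 0 (:- con (+ 0) := con (+ 0)) refl ⟩
        0#                        ∎))

  eval-nonneg : ∀ f → NonnegativeCoefficients f → ∀ {x} → 0# ≤ x → 0# ≤ eval f x
  eval-nonneg []      0≤f 0≤x = ≤-refl
  eval-nonneg (a ∷ f) 0≤f 0≤x = +-nonneg (0≤f 0) (*-nonNeg 0≤x (eval-nonneg f (0≤f ∘ suc) 0≤x))

  eval-pos : ∀ f → NonnegativeCoefficients f → ∀ k → coeff f k ≉ 0# → ∀ {x} → 0# < x → 0# < eval f x
  eval-pos []      0≤f k       fₖ≉0 0<x = contradiction refl fₖ≉0
  eval-pos (a ∷ f) 0≤f zero    a≉0  0<x =
    pos+nonneg (0≤f 0 , λ 0≈a → a≉0 (sym 0≈a)) (*-nonNeg (proj₁ 0<x) (eval-nonneg f (0≤f ∘ suc) (proj₁ 0<x)))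
  eval-pos (a ∷ f) 0≤f (suc k) fₖ≉0 0<x = nonneg+pos (0≤f 0) (*-pos 0<x (eval-pos f (0≤f ∘ suc) k fₖ≉0 0<x))

  -- y₀² K(y) − y² K(y₀) = (y₀ − y) E(y) with E a nonnegative combination of −b₃, b₁ and b₀:
  -- unless K vanishes identically it changes sign at y₀, and then so does g at x₀.
  sign-preserving-cubic : ∀ g (b : Fin 4 → Carrier) {r x₀} → r ≤ 0# → 0# < x₀ →
    0# ≤ - b 3F → 0# ≤ b 1F → 0# ≤ b 0F →
    (∀ x → 0# < x → 0# ≤ eval g x * cubic commutativeRing b (x - r)) →
    eval g x₀ ≉ 0# → cubic commutativeRing b (x₀ - r) ≈ 0# → ∀ i → b i ≈ 0#
  sign-preserving-cubic g b {r} {x₀} r≤0 0<x₀ 0≤-b₃ 0≤b₁ 0≤b₀ same-sign g≉0 K≈0 = λ where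
      0F → b₀≈0
      1F → b₁≈0
      2F → x≉0∧xy≈0⇒y≈0 (pos⇒≉0 (*-pos 0<y₀ 0<y₀)) (begin
        y₀ * y₀ * b 2F            ≈⟨ solve 2 (λ y b₂ → y :* y :* b₂ :=
                                       con (+ 0) :+ con (+ 0) :* y :+ b₂ :* (y :* y) :+ con (+ 0) :* (y :* y :* y)) refl y₀ (b 2F) ⟩
        0# + 0# * y₀ + b 2F * (y₀ * y₀) + 0# * (y₀ * y₀ * y₀)
                                  ≈⟨ +-cong (+-cong (+-cong b₀≈0 (*-congʳ b₁≈0)) refl) (*-congʳ b₃≈0) ⟨
        cubic commutativeRing b y₀ ≈⟨ K≈0 ⟩
        0#                        ∎)
      3F → b₃≈0
    where
    y₀ = x₀ - r

    0<x-r : ∀ {x} → 0# < x → 0# < x - r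
    0<x-r 0<x = pos+nonneg 0<x (neg-nonneg r≤0)

    0<y₀ : 0# < y₀
    0<y₀ = 0<x-r 0<x₀

    E : Carrier → Carrier
    E y = - b 3F * (y * y * (y₀ * y₀)) + b 1F * (y * y₀) + b 0F * (y + y₀)

    not-positive : ¬ (∀ y → 0# < y → 0# < E y)
    not-positive 0<E = g≉0 (sign-change⇒zero g 0<x₀ λ x 0<x →
      cancel-pos (0<E (x - r) (0<x-r 0<x)) (≤-respʳ-≈ (begin
        y₀ * y₀ * (eval g x * cubic commutativeRing b (x - r))
          ≈⟨ solve 7 (λ b₀ b₁ b₂ b₃ y y₀ g → let K = λ y → b₀ :+ b₁ :* y :+ b₂ :* (y :* y) :+ b₃ :* (y :* y :* y) in
               y₀ :* y₀ :* (g :* K y) :=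
               (:- b₃ :* (y :* y :* (y₀ :* y₀)) :+ b₁ :* (y :* y₀) :+ b₀ :* (y :+ y₀)) :* ((y₀ :- y) :* g)
                 :+ y :* y :* g :* K y₀)
               refl (b 0F) (b 1F) (b 2F) (b 3F) (x - r) y₀ (eval g x) ⟩
        E (x - r) * ((y₀ - (x - r)) * eval g x) + (x - r) * (x - r) * eval g x * cubic commutativeRing b y₀
          ≈⟨ +-congʳ (*-congˡ (*-congʳ (solve 3 (λ x x₀ r → (x₀ :- r) :- (x :- r) := x₀ :- x) refl x x₀ r))) ⟩
        E (x - r) * ((x₀ - x) * eval g x) + (x - r) * (x - r) * eval g x * cubic commutativeRing b y₀
          ≈⟨ +-congˡ (trans (*-congˡ K≈0) (zeroʳ _)) ⟩
        E (x - r) * ((x₀ - x) * eval g x) + 0#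
          ≈⟨ +-identityʳ _ ⟩
        E (x - r) * ((x₀ - x) * eval g x) ∎)
        (*-nonNeg (square-nonneg y₀) (same-sign x 0<x))))

    0≤E₃ : ∀ {y} → 0# < y → 0# ≤ - b 3F * (y * y * (y₀ * y₀))
    0≤E₃ {y} 0<y = *-nonNeg 0≤-b₃ (*-nonNeg (square-nonneg y) (square-nonneg y₀))
    0≤E₁ : ∀ {y} → 0# < y → 0# ≤ b 1F * (y * y₀)
    0≤E₁ 0<y = *-nonNeg 0≤b₁ (*-nonNeg (proj₁ 0<y) (proj₁ 0<y₀))
    0≤E₀ : ∀ {y} → 0# < y → 0# ≤ b 0F * (y + y₀)
    0≤E₀ 0<y = *-nonNeg 0≤b₀ (+-nonneg (proj₁ 0<y) (proj₁ 0<y₀))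

    nonneg∧¬pos⇒≈0 : ∀ {x} → 0# ≤ x → ¬ (0# < x) → x ≈ 0#
    nonneg∧¬pos⇒≈0 {x} 0≤x ¬0<x with x ≟ 0#
    ... | yes x≈0 = x≈0
    ... | no  x≉0 = contradiction (0≤x , λ 0≈x → x≉0 (sym 0≈x)) ¬0<x

    -- The three factors multiplying -b₃, b₁ and b₀ in `E` are positive at positive arguments, so a
    -- single positive coefficient would make `E` positive throughout.
    b₀≈0 : b 0F ≈ 0#
    b₀≈0 = nonneg∧¬pos⇒≈0 0≤b₀ λ 0<b₀ → not-positive λ y 0<y →
      nonneg+pos (+-nonneg (0≤E₃ 0<y) (0≤E₁ 0<y)) (*-pos 0<b₀ (pos+nonneg 0<y (proj₁ 0<y₀)))
    b₁≈0 : b 1F ≈ 0#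
    b₁≈0 = nonneg∧¬pos⇒≈0 0≤b₁ λ 0<b₁ → not-positive λ y 0<y →
      pos+nonneg (nonneg+pos (0≤E₃ 0<y) (*-pos 0<b₁ (*-pos 0<y 0<y₀))) (0≤E₀ 0<y)
    b₃≈0 : b 3F ≈ 0#
    b₃≈0 = trans (solve 1 (λ b → b := :- (:- b)) refl (b 3F)) (trans (-‿cong
      (nonneg∧¬pos⇒≈0 0≤-b₃ λ 0<-b₃ → not-positive λ y 0<y →
        pos+nonneg (pos+nonneg (*-pos 0<-b₃ (*-pos (*-pos 0<y 0<y) (*-pos 0<y₀ 0<y₀))) (0≤E₁ 0<y)) (0≤E₀ 0<y)))
      (solve 0 (:- con (+ 0) := con (+ 0)) refl))

-- Vanishing sums of cubics at nonreal and real points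

module CubicSums {c ℓ₁ ℓ₂} (𝓡 : CompleteOrderedField c ℓ₁ ℓ₂) where
  open OrderedField 𝓡
  open RealEvaluation 𝓡
  open RealPolynomial 𝓡 using (Poly; eval)
  open SemiringSum semiring using (*-distribˡ-sum; sum-cong-≋)
  open SetoidReasoning setoid

  sum-scale≈0 : ∀ {n} x (f : Fin n → Carrier) → sum f ≈ 0# → sum (λ k → x * f k) ≈ 0#
  sum-scale≈0 x f Σf≈0 = trans (sym (*-distribˡ-sum x f)) (trans (*-congˡ Σf≈0) (zeroʳ x))

  -- With w = x − r k + i v and 1/|w|² = i k, these are Re and Im / v of A₃ w + A₂ + A₁/w + A₀/w².
  module _ {n} (r : Fin n → Carrier) (A : Fin n → Fin 4 → Carrier) (x v : Carrier) (i : Fin n → Carrier) where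
    re im/v : Fin n → Carrier
    re k   = A k 3F * (x - r k) + A k 2F + A k 1F * ((x - r k) * i k)
               + A k 0F * (((x - r k) * (x - r k) - v * v) * (i k * i k))
    im/v k = A k 3F - A k 1F * i k - (A k 0F + A k 0F) * ((x - r k) * (i k * i k))

  module _ {n} (h : Poly) (r : Fin n → Carrier) (A : Fin n → Fin 4 → Carrier) {ε η : Carrier}
    (r≤0 : ∀ k → r k ≤ 0#) (ε≉0 : ε ≉ 0#) (η≉0 : η ≉ 0#)
    (0≤-εA₃ : ∀ k → 0# ≤ ε * - A k 3F) (0≤εA₁ : ∀ k → 0# ≤ ε * A k 1F) (0≤εA₀ : ∀ k → 0# ≤ ε * A k 0F)
    (same-sign : ∀ k x → 0# < x → 0# ≤ η * (eval h x * cubic commutativeRing (A k) (x - r k)))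
    (h≉0 : ∀ x → 0# < x → eval h x ≉ 0#)
    {x v : Carrier} (0<x : 0# < x) (i : Fin n → Carrier) (0<i : ∀ k → 0# < i k)
    (norm-inverse : ∀ k → ((x - r k) * (x - r k) + v * v) * i k ≈ 1#)
    where

    private
      u Re Im/v : Fin n → Carrier
      u k  = x - r k
      Re   = re r A x v i
      Im/v = im/v r A x v i

      0<u : ∀ k {y} → 0# < y → 0# < y - r k
      0<u k 0<y = pos+nonneg 0<y (neg-nonneg (r≤0 k))

    -- Multiplied by -ε, the imaginary sum has the nonnegative terms `a₃ k + a₁ k + a₀ k`, where Re
    -- w > 0 makes the factor of A₀ positive. So A₃, A₁ and A₀ vanish, each cubic shrinks to A₂ y²,
    -- and the sign hypothesis becomes one on A₂ itself.
    nonreal⇒A≈0 : sum Re ≈ 0# → sum Im/v ≈ 0# → ∀ k l → A k l ≈ 0#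
    nonreal⇒A≈0 Σre≈0 Σim≈0 k = λ where
        0F → A₀≈0 k
        1F → A₁≈0 k
        -- The point 1 is an arbitrary positive real: evaluated there, the sign hypothesis makes all
        -- the numbers η h(1) A₂ nonnegative, with the same nonzero factor η h(1) for every k.
        2F → x≉0∧xy≈0⇒y≈0 (*-≉0 η≉0 (h≉0 1# 0<1))
               (sum≈0⇒term≈0 (λ k → η * eval h 1# * A k 2F) 0≤A₂
                 (sum-scale≈0 (η * eval h 1#) (λ k → A k 2F) (trans (sum-cong-≋ {n} re≈A₂) Σre≈0)) k)
        3F → A₃≈0 k
      where
      a₃ a₁ a₀ : Fin n → Carrier
      a₃ k = ε * - A k 3F
      a₁ k = ε * A k 1F * i k
      a₀ k = ε * A k 0F * ((u k + u k) * (i k * i k))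

      0≤a₁ : ∀ k → 0# ≤ a₁ k
      0≤a₁ k = *-nonNeg (0≤εA₁ k) (proj₁ (0<i k))
      0<c₀ : ∀ k → 0# < (u k + u k) * (i k * i k)
      0<c₀ k = *-pos (pos+nonneg (0<u k 0<x) (proj₁ (0<u k 0<x))) (*-pos (0<i k) (0<i k))
      0≤a₀ : ∀ k → 0# ≤ a₀ k
      0≤a₀ k = *-nonNeg (0≤εA₀ k) (proj₁ (0<c₀ k))

      terms≈0 : ∀ k → a₃ k + a₁ k + a₀ k ≈ 0#
      terms≈0 = sum≈0⇒term≈0 (λ k → a₃ k + a₁ k + a₀ k) (λ k → +-nonneg (+-nonneg (0≤-εA₃ k) (0≤a₁ k)) (0≤a₀ k))
        (trans (sum-cong-≋ {n} λ k →
            solve 6 (λ e a₃ a₁ a₀ u i → e :* (:- a₃) :+ e :* a₁ :* i :+ e :* a₀ :* ((u :+ u) :* (i :* i)) :=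
              :- e :* (a₃ :- a₁ :* i :- (a₀ :+ a₀) :* (u :* (i :* i))))
              refl ε (A k 3F) (A k 1F) (A k 0F) (u k) (i k))
          (sum-scale≈0 (- ε) Im/v Σim≈0))

      A₃≈0 : ∀ k → A k 3F ≈ 0#
      A₃≈0 k = trans (solve 1 (λ b → b := :- (:- b)) refl (A k 3F)) (trans (-‿cong
        (x≉0∧xy≈0⇒y≈0 ε≉0 (x+y≈0⇒x≈0 (0≤-εA₃ k) (0≤a₁ k)
          (x+y≈0⇒x≈0 (+-nonneg (0≤-εA₃ k) (0≤a₁ k)) (0≤a₀ k) (terms≈0 k)))))
        (solve 0 (:- con (+ 0) := con (+ 0)) refl))
      A₁≈0 : ∀ k → A k 1F ≈ 0#
      A₁≈0 k = x≉0∧xy≈0⇒y≈0 ε≉0 (x≉0∧xy≈0⇒y≈0 (pos⇒≉0 (0<i k)) (trans (*-comm _ _)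
        (x+y≈0⇒y≈0 (0≤-εA₃ k) (0≤a₁ k) (x+y≈0⇒x≈0 (+-nonneg (0≤-εA₃ k) (0≤a₁ k)) (0≤a₀ k) (terms≈0 k)))))
      A₀≈0 : ∀ k → A k 0F ≈ 0#
      A₀≈0 k = x≉0∧xy≈0⇒y≈0 ε≉0 (x≉0∧xy≈0⇒y≈0 (pos⇒≉0 (0<c₀ k)) (trans (*-comm _ _)
        (x+y≈0⇒y≈0 (+-nonneg (0≤-εA₃ k) (0≤a₁ k)) (0≤a₀ k) (terms≈0 k))))

      re≈A₂ : ∀ k → A k 2F ≈ Re k
      re≈A₂ k = begin
        A k 2F
          ≈⟨ solve 4 (λ a x y z → a := con (+ 0) :* x :+ a :+ con (+ 0) :* y :+ con (+ 0) :* z) refl (A k 2F) _ _ _ ⟩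
        0# * u k + A k 2F + 0# * (u k * i k) + 0# * ((u k * u k - v * v) * (i k * i k))
          ≈⟨ +-cong (+-cong (+-congʳ (*-congʳ (A₃≈0 k))) (*-congʳ (A₁≈0 k))) (*-congʳ (A₀≈0 k)) ⟨
        Re k ∎

      0≤A₂ : ∀ k → 0# ≤ η * eval h 1# * A k 2F
      0≤A₂ k = cancel-pos (*-pos (0<u k 0<1) (0<u k 0<1)) (≤-respʳ-≈ (begin
        η * (eval h 1# * cubic commutativeRing (A k) (1# - r k))
          ≈⟨ *-congˡ (*-congˡ (+-cong (+-cong (+-cong (A₀≈0 k) (*-congʳ (A₁≈0 k))) refl) (*-congʳ (A₃≈0 k)))) ⟩
        η * (eval h 1# * (0# + 0# * y + A k 2F * (y * y) + 0# * (y * y * y)))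
          ≈⟨ solve 4 (λ e h a y → e :* (h :* (con (+ 0) :+ con (+ 0) :* y :+ a :* (y :* y) :+ con (+ 0) :* (y :* y :* y)))
               := y :* y :* (e :* h :* a)) refl η (eval h 1#) (A k 2F) y ⟩
        y * y * (η * eval h 1# * A k 2F) ∎)
        (same-sign k 1# 0<1))
        where
        y = 1# - r k

    -- For v = 0 the k-th real part is the cubic at x - r k times `i k` > 0, so η h(x) gives all
    -- terms one sign and each cubic vanishes at x. From there each cubic is treated separately.
    real⇒A≈0 : v ≈ 0# → sum Re ≈ 0# → ∀ k l → A k l ≈ 0#
    real⇒A≈0 v≈0 Σre≈0 k l = x≉0∧xy≈0⇒y≈0 ε≉0
      (sign-preserving-cubic g (λ l → ε * A k l) (r≤0 k) 0<x
        (≤-respʳ-≈ (solve 2 (λ e a → e :* :- a := :- (e :* a)) refl ε (A k 3F)) (0≤-εA₃ k)) (0≤εA₁ k) (0≤εA₀ k)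
        (λ y 0<y → ≤-respʳ-≈ (begin
          ε * ε * (η * (eval h y * cubic commutativeRing (A k) (y - r k)))
            ≈⟨ solve 4 (λ e n h K → e :* e :* (n :* (h :* K)) := (e :* n) :* h :* (e :* K)) refl ε η (eval h y) _ ⟩
          (ε * η) * eval h y * (ε * cubic commutativeRing (A k) (y - r k))
            ≈⟨ *-cong (EvaluateAt.ev-scale y (ε * η) h) (EvaluateCubicAt.cubic-scale 0# ε (A k) (y - r k)) ⟨
          eval g y * cubic commutativeRing (λ l → ε * A k l) (y - r k) ∎)
          (*-nonNeg (square-nonneg ε) (same-sign k y 0<y)))
        (λ gx≈0 → *-≉0 (*-≉0 ε≉0 η≉0) (h≉0 x 0<x) (trans (sym (EvaluateAt.ev-scale x (ε * η) h)) gx≈0))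
        (trans (EvaluateCubicAt.cubic-scale 0# ε (A k) (u k)) (trans (*-congˡ K≈0) (zeroʳ ε))) l)
      where
      -- The cubic is scaled by ε to obtain the required coefficient signs, and h by ε η, so that
      -- their product is ε² times the nonnegative quantity η h K.
      g = List.map ((ε * η) *_) h

      [uu]i≈1 : ∀ k → u k * u k * i k ≈ 1#
      [uu]i≈1 k = trans (*-congʳ (sym (trans (+-congˡ (trans (*-congʳ v≈0) (zeroˡ v))) (+-identityʳ _)))) (norm-inverse k)

      re≈K*i : ∀ k → Re k ≈ cubic commutativeRing (A k) (u k) * i k
      re≈K*i k = begin
        Re k
          ≈⟨ +-congˡ (*-congˡ (*-congʳ (+-congˡ (-‿cong (trans (*-congʳ v≈0) (zeroˡ v)))))) ⟩
        A k 3F * u k + A k 2F + A k 1F * (u k * i k) + A k 0F * ((u k * u k - 0#) * (i k * i k))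
          ≈⟨ solve 6 (λ a₀ a₁ a₂ a₃ u i →
               a₃ :* u :+ a₂ :+ a₁ :* (u :* i) :+ a₀ :* ((u :* u :- con (+ 0)) :* (i :* i)) :=
               (a₃ :* u :+ a₂) :* con (+ 1) :+ a₁ :* (u :* i) :+ a₀ :* ((u :* u :* i) :* i))
               refl (A k 0F) (A k 1F) (A k 2F) (A k 3F) (u k) (i k) ⟩
        (A k 3F * u k + A k 2F) * 1# + A k 1F * (u k * i k) + A k 0F * ((u k * u k * i k) * i k)
          ≈⟨ +-cong (+-congʳ (*-congˡ (sym ([uu]i≈1 k)))) (*-congˡ (*-congʳ ([uu]i≈1 k))) ⟩
        (A k 3F * u k + A k 2F) * (u k * u k * i k) + A k 1F * (u k * i k) + A k 0F * (1# * i k)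
          ≈⟨ solve 6 (λ a₀ a₁ a₂ a₃ u i →
               (a₃ :* u :+ a₂) :* (u :* u :* i) :+ a₁ :* (u :* i) :+ a₀ :* (con (+ 1) :* i) :=
               (a₀ :+ a₁ :* u :+ a₂ :* (u :* u) :+ a₃ :* (u :* u :* u)) :* i)
               refl (A k 0F) (A k 1F) (A k 2F) (A k 3F) (u k) (i k) ⟩
        cubic commutativeRing (A k) (u k) * i k ∎

      K≈0 : cubic commutativeRing (A k) (u k) ≈ 0#
      K≈0 = x≉0∧xy≈0⇒y≈0 (pos⇒≉0 (0<i k)) (trans (*-comm _ _) (trans (sym (re≈K*i k))
        (x≉0∧xy≈0⇒y≈0 (*-≉0 η≉0 (h≉0 x 0<x))
          (sum≈0⇒term≈0 (λ k → η * eval h x * Re k)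
            (λ k → ≤-respʳ-≈ (trans
                (solve 4 (λ e h K i → e :* (h :* K) :* i := e :* h :* (K :* i)) refl η (eval h x) _ (i k))
                (*-congˡ (sym (re≈K*i k))))
              (*-nonNeg (same-sign k x 0<x) (proj₁ (0<i k))))
            (sum-scale≈0 (η * eval h x) Re Σre≈0) k))))

-- The Turán expression as a weighted sum of cubics

module TuránIdentity {c ℓ₁ ℓ₂} (𝓡 : CompleteOrderedField c ℓ₁ ℓ₂) (S : CommutativeRing c ℓ₁)
  {φ : CompleteOrderedField.Carrier 𝓡 → CommutativeRing.Carrier S}
  (φ-isHom : RingMorphisms.IsRingHomomorphism (CompleteOrderedField.rawRing 𝓡) (CommutativeRing.rawRing S) φ)
  (z : CommutativeRing.Carrier S) where

  private module ℝ = OrderedField 𝓡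
  open RealPolynomial 𝓡 hiding (_≈_; -_; _≤_; _<_; 0#)
  open CommutativeRing S hiding (zero)
  open DualNumbers ℝ.commutativeRing S φ-isHom
  open Evaluation ℝ.commutativeRing S φ-isHom z
  private
    module D = CommutativeRing dual
    module Dual = Evaluation ℝ.commutativeRing dual φ+ε0-isHom (z , 1#)
  open DualWronskian S
  open OmittedProducts S
  open OmittedProducts dual using () renaming (omit to omitᴰ)
  open RawSemiringDefinitions (Semiring.rawSemiring semiring) using (sum)
  open RawSemiringDefinitions (Semiring.rawSemiring D.semiring) using () renaming (sum to sumᴰ; product to productᴰ)
  open SemiringSum semiring using (*-distribˡ-sum; sum-cong-≋)
  open IntegerSolver S
  open SetoidReasoning setoid

  -- The recurrences turn f₁² - f₂ f₀ into q (f₁ f₀′ - f₁′ f₀) - (p₁ - p₀) f₁ f₀, which is the left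
  -- side of `wronskian-sum` for f₁ in factored form and f₀ in partial fractions.
  turán-identity : ∀ {m} (f₀ f₁ f₂ p₀ p₁ q h : Poly) (e : ℝ)
    (r b : Fin (suc m) → ℝ) (a : Fin (suc m) → Fin 4 → ℝ) →
    (let w = λ k → (z , 1#) D.- (φ (r k) , 0#) ; ω = λ k → z - φ (r k)) →
    f₁ ≈ₚ p₀ *ₚ f₀ +ₚ q *ₚ derivative f₀ →
    f₂ ≈ₚ p₁ *ₚ f₁ +ₚ q *ₚ derivative f₁ →
    Dual.ev f₁ D.≈ (φ e , 0#) D.* productᴰ w →
    Dual.ev f₀ D.≈ sumᴰ (λ k → (φ (b k) , 0#) D.* omitᴰ w k) →
    (∀ k → φ (b k) * (ω k * (ev p₁ - ev p₀) + ev q) ≈ ev h * cubic S (φ ∘ a k) (ω k)) →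
    ev (f₁ ^ₚ 2 -ₚ f₂ *ₚ f₀) ≈
      - φ e * (ev h * sum (λ k → cubic S (φ ∘ a k) (ω k) * (omit ω k * omit ω k)))
  turán-identity {m} f₀ f₁ f₂ p₀ p₁ q h e r b a f₁≈ f₂≈ F≈ G≈ h-cubic = begin
    ev (f₁ ^ₚ 2 -ₚ f₂ *ₚ f₀)
      ≈⟨ trans (ev-- (f₁ ^ₚ 2) (f₂ *ₚ f₀)) (+-cong (ev-^ f₁ (recurrence f₁ p₀ f₀ f₁≈) 2) (-‿cong (ev-* f₂ f₀))) ⟩
    (P₀ * F₀ + Q * F₁) * ((P₀ * F₀ + Q * F₁) * 1#) - ev f₂ * F₀
      -- One factor of the square is folded back to f₁, so that each term is bilinear in the data of
      -- f₀ and those of f₁, and the terms p₀ f₀ f₁ and p₁ f₁ f₀ combine.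
      ≈⟨ +-cong (*-congˡ (trans (*-identityʳ _) (sym (recurrence f₁ p₀ f₀ f₁≈)))) (-‿cong (*-congʳ (recurrence f₂ p₁ f₁ f₂≈))) ⟩
    (P₀ * F₀ + Q * F₁) * G₀ - (P₁ * G₀ + Q * G₁) * F₀
      ≈⟨ solve 7 (λ p p′ q f f′ g g′ → (p :* f :+ q :* f′) :* g :- (p′ :* g :+ q :* g′) :* f :=
           q :* (g :* f′ :- g′ :* f) :- (p′ :- p) :* g :* f) refl P₀ P₁ Q F₀ F₁ G₀ G₁ ⟩
    Q * (G₀ * F₁ - G₁ * F₀) - (P₁ - P₀) * G₀ * F₀
      ≈⟨ wronskian-sum (λ k → (z , 1#) D.- (φ (r k) , 0#))
           (λ _ → solve 0 (con (+ 1) :- con (+ 0) := con (+ 1)) refl)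
           (φ e) (P₁ - P₀) Q (φ ∘ b) (G₀ , G₁) (F₀ , F₁)
           (D.trans (D.sym (ev-dual z f₁)) F≈) (D.trans (D.sym (ev-dual z f₀)) G≈) ⟩
    - φ e * sum (λ k → φ (b k) * ((ω k * (P₁ - P₀) + Q) * (omit ω k * omit ω k)))
      ≈⟨ *-congˡ (sum-cong-≋ {suc m} λ k → trans (sym (*-assoc _ _ (omit ω k * omit ω k)))
           (trans (*-congʳ (h-cubic k)) (*-assoc _ _ (omit ω k * omit ω k)))) ⟩
    - φ e * sum (λ k → ev h * (cubic S (φ ∘ a k) (ω k) * (omit ω k * omit ω k)))
      ≈⟨ *-congˡ (*-distribˡ-sum (ev h) (λ k → cubic S (φ ∘ a k) (ω k) * (omit ω k * omit ω k))) ⟨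
    - φ e * (ev h * sum (λ k → cubic S (φ ∘ a k) (ω k) * (omit ω k * omit ω k))) ∎
    where
    P₀ = ev p₀
    P₁ = ev p₁
    Q  = ev q
    F₀ = ev f₀
    F₁ = ev (derivative f₀)
    G₀ = ev f₁
    G₁ = ev (derivative f₁)
    ω : Fin (suc m) → Carrier
    ω k = z - φ (r k)

    recurrence : ∀ g p f → g ≈ₚ p *ₚ f +ₚ q *ₚ derivative f → ev g ≈ ev p * ev f + ev q * ev (derivative f)
    recurrence g p f g≈ = trans (ev-cong g (p *ₚ f +ₚ q *ₚ derivative f) g≈) (trans (ev-+ (p *ₚ f) (q *ₚ derivative f))
      (+-cong (ev-* p f) (ev-* q (derivative f))))

module TuránFormula {c ℓ₁ ℓ₂} (𝓡 : CompleteOrderedField c ℓ₁ ℓ₂) (S : CommutativeRing c ℓ₁)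
  {φ : CompleteOrderedField.Carrier 𝓡 → CommutativeRing.Carrier S}
  (φ-isHom : RingMorphisms.IsRingHomomorphism (CompleteOrderedField.rawRing 𝓡) (CommutativeRing.rawRing S) φ)
  where

  private module ℝ = OrderedField 𝓡
  open RealPolynomial 𝓡 hiding (_≈_; -_; _≤_; _<_; 0#)
  open CommutativeRing S hiding (zero)
  open DualNumbers ℝ.commutativeRing S φ-isHom
  private module D = CommutativeRing dual
  open OmittedProducts S
  open OmittedProducts dual using () renaming (omit to omitᴰ)
  open RawSemiringDefinitions (Semiring.rawSemiring D.semiring) using () renaming (sum to sumᴰ)
  open RawSemiringDefinitions (Semiring.rawSemiring semiring) using (sum; product)
  open SemiringSum semiring using (sum-cong-≋; sum-replicate-zero)
  open RingMorphisms.IsRingHomomorphism φ-isHom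
  open IntegerSolver S
  open SetoidReasoning setoid
  open Evaluation ℝ.commutativeRing S φ-isHom using (ev)

  module Recurrence (f₀ f₁ f₂ p₀ p₁ q h : Poly) {N} (ρ : Fin N → ℝ) (α : Fin N → Fin 4 → ℝ)
    (f₁≈ : f₁ ≈ₚ p₀ *ₚ f₀ +ₚ q *ₚ derivative f₀)
    (f₂≈ : f₂ ≈ₚ p₁ *ₚ f₁ +ₚ q *ₚ derivative f₁)
    {m} (r : Fin (suc m) → ℝ)
    (f₁-factored : f₁ ≈ₚ C (coeff f₁ (suc m)) *ₚ productₚ (λ i → X -ₚ C (r i)))
    (b : Fin (suc m) → ℝ)
    (f₀-fractions : ∀ z → Evaluation.ev ℝ.commutativeRing dual φ+ε0-isHom z f₀ D.≈
      sumᴰ (λ k → (φ (b k) , 0#) D.* omitᴰ (λ i → z D.- (φ (r i) , 0#)) k))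
    (h-cubic : ∀ k → (X -ₚ C (ρ k)) *ₚ (p₁ -ₚ p₀) +ₚ q ≈ₚ h *ₚ cubicAt (ρ k) (α k))
    (index : Fin (suc m) → Fin N) (r≈ρ : ∀ k → r k ℝ.≈ ρ (index k))
    where

    private
      e : ℝ
      e = coeff f₁ (suc m)

    -- The zeros come in two lists: `r`, ordered by the interlacing, and `ρ`, to which the cubics
    -- `α` belong. `index` may repeat entries, since each summand only uses the cubic at its own
    -- zero. With the weight absorbed, a zero weight counts as a zero cubic, which is what the final
    -- case distinction needs.
    A : Fin (suc m) → Fin 4 → ℝ
    A k l = b k ℝ.* α (index k) l

    module _ (z : Carrier) where
      ω : Fin (suc m) → Carrier
      ω k = z - φ (r k)

      cubics : Carrier
      cubics = sum (λ k → cubic S (φ ∘ A k) (ω k) * (omit ω k * omit ω k))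

      private
        weighted-cubic : ∀ k → φ (b k) * (ω k * (ev z p₁ - ev z p₀) + ev z q) ≈ ev z h * cubic S (φ ∘ A k) (ω k)
        weighted-cubic k = begin
          φ (b k) * (ω k * (ev z p₁ - ev z p₀) + ev z q)
            ≈⟨ *-congˡ (+-congʳ (*-cong (+-congˡ (-‿cong (⟦⟧-cong (r≈ρ k)))) (sym (ev-- p₁ p₀)))) ⟩
          φ (b k) * ((z - φ (ρ j)) * ev z (p₁ -ₚ p₀) + ev z q)
            ≈⟨ *-congˡ (trans (ev-+ ((X -ₚ C (ρ j)) *ₚ (p₁ -ₚ p₀)) q)
                 (+-congʳ (trans (ev-* (X -ₚ C (ρ j)) (p₁ -ₚ p₀)) (*-congʳ (ev-X-C (ρ j)))))) ⟨
          φ (b k) * ev z ((X -ₚ C (ρ j)) *ₚ (p₁ -ₚ p₀) +ₚ q)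
            ≈⟨ *-congˡ (trans (ev-cong ((X -ₚ C (ρ j)) *ₚ (p₁ -ₚ p₀) +ₚ q) (h *ₚ cubicAt (ρ j) (α j)) (h-cubic j))
                 (ev-*-cubicAt h (α j) (r≈ρ k))) ⟩
          φ (b k) * (ev z h * cubic S (φ ∘ α j) (ω k))
            ≈⟨ solve 3 (λ b h K → b :* (h :* K) := h :* (b :* K)) refl (φ (b k)) (ev z h) _ ⟩
          ev z h * (φ (b k) * cubic S (φ ∘ α j) (ω k))
            ≈⟨ *-congˡ (cubic-scale (b k) (α j) (ω k)) ⟨
          ev z h * cubic S (φ ∘ A k) (ω k) ∎
          where
          open Evaluation ℝ.commutativeRing S φ-isHom z hiding (ev)
          open CubicEvaluation 𝓡 S φ-isHom z
          j = index k

      ℑ-value : ev z (f₁ ^ₚ 2 -ₚ f₂ *ₚ f₀) ≈ - φ e * (ev z h * cubics)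
      ℑ-value = TuránIdentity.turán-identity 𝓡 S φ-isHom z f₀ f₁ f₂ p₀ p₁ q h e r b A f₁≈ f₂≈
        (Interlacing.ev-factored 𝓡 dual φ+ε0-isHom (z , 1#) f₁ r f₁-factored)
        (f₀-fractions (z , 1#)) weighted-cubic

      ev-h≈0⇒ev-ℑ≈0 : ev z h ≈ 0# → ev z (f₁ ^ₚ 2 -ₚ f₂ *ₚ f₀) ≈ 0#
      ev-h≈0⇒ev-ℑ≈0 h≈0 = trans ℑ-value (trans (*-congˡ (trans (*-congʳ h≈0) (zeroˡ _))) (zeroʳ _))

      A≈0⇒ev-ℑ≈0 : (∀ k l → A k l ℝ.≈ ℝ.0#) → ev z (f₁ ^ₚ 2 -ₚ f₂ *ₚ f₀) ≈ 0#
      A≈0⇒ev-ℑ≈0 A≈0 = trans ℑ-value (trans (*-congˡ (trans (*-congˡ cubics≈0) (zeroʳ _))) (zeroʳ _))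
        where
        φA≈0 : ∀ k l → φ (A k l) ≈ 0#
        φA≈0 k l = trans (⟦⟧-cong (A≈0 k l)) 0#-homo

        cubics≈0 : cubics ≈ 0#
        cubics≈0 = trans (sum-cong-≋ {suc m} λ k → begin
            cubic S (φ ∘ A k) (ω k) * (omit ω k * omit ω k)
              ≈⟨ *-congʳ (+-cong (+-cong (+-cong (φA≈0 k 0F) (*-congʳ (φA≈0 k 1F))) (*-congʳ (φA≈0 k 2F))) (*-congʳ (φA≈0 k 3F))) ⟩
            (0# + 0# * ω k + 0# * (ω k * ω k) + 0# * (ω k * ω k * ω k)) * (omit ω k * omit ω k)
              ≈⟨ solve 2 (λ w o → (con (+ 0) :+ con (+ 0) :* w :+ con (+ 0) :* (w :* w) :+ con (+ 0) :* (w :* w :* w)) :* o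
                   := con (+ 0)) refl (ω k) _ ⟩
            0# ∎)
          (sum-replicate-zero (suc m))

      -- `S` is only a commutative ring here, so cancellation is passed in as an argument. It
      -- removes e, h and then, twice, the product of all factors z - r k.
      ev-ℑ≈0⇒Σ≈0 : (∀ {x y} → x ≉ 0# → x * y ≈ 0# → y ≈ 0#) → φ e ≉ 0# → ev z h ≉ 0# →
        ∀ j → (∀ k → ω k * j k ≈ 1#) → (∀ k → ω k ≉ 0#) →
        ev z (f₁ ^ₚ 2 -ₚ f₂ *ₚ f₀) ≈ 0# → sum (λ k → reciprocalCubic S (φ ∘ A k) (ω k) (j k)) ≈ 0#
      ev-ℑ≈0⇒Σ≈0 cancel φe≉0 h≉0 j ωj≈1 ω≉0 ℑ≈0 = ∏-cancel ω ω≉0 (∏-cancel ω ω≉0 (trans (sym (*-assoc _ _ _))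
        (trans (sym (sum-cubic-omit² ω j (λ k → φ ∘ A k) ωj≈1))
          (cancel h≉0 (cancel φe≉0 (begin
            φ e * (ev z h * cubics)         ≈⟨ solve 2 (λ x y → x :* y := :- (:- x :* y)) refl _ _ ⟩
            - (- φ e * (ev z h * cubics))   ≈⟨ -‿cong (trans (sym ℑ-value) ℑ≈0) ⟩
            - 0#                            ≈⟨ solve 0 (:- con (+ 0) := con (+ 0)) refl ⟩
            0#                              ∎))))))
        where
        ∏-cancel : ∀ {n} (w : Fin n → Carrier) → (∀ k → w k ≉ 0#) → ∀ {y} → product w * y ≈ 0# → y ≈ 0#
        ∏-cancel {zero}  w w≉0 ∏y≈0 = trans (sym (*-identityˡ _)) ∏y≈0
        ∏-cancel {suc n} w w≉0 ∏y≈0 = ∏-cancel (w ∘ suc) (w≉0 ∘ suc)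
          (cancel (w≉0 zero) (trans (sym (*-assoc _ _ _)) ∏y≈0))

-- The complex field and its two presentations

module ComplexField {c ℓ₁ ℓ₂} (𝓡 : CompleteOrderedField c ℓ₁ ℓ₂) where
  open OrderedField 𝓡
  open QuadraticExtension commutativeRing (- 1#) public
    using (embed; embed-isRingHomomorphism) renaming (adjoin to complexRing)
  open RealPolynomial 𝓡 using (eval; coeff; toℂ[x])
  open Complex 𝓡 using (ℂ-rawRing)
  private
    module ℂ = CommutativeRing complexRing
    module ℂ[x] = Polynomial ℂ-rawRing

  norm-pos : ∀ {x y} → ¬ ((x , y) ℂ.≈ ℂ.0#) → 0# < x * x + y * y
  norm-pos {x} {y} z≉0 with x ≟ 0# | y ≟ 0#
  ... | yes x≈0 | yes y≈0 = contradiction (x≈0 , y≈0) z≉0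
  ... | no  x≉0 | _       = pos+nonneg (square-nonneg x , λ 0≈xx → *-≉0 x≉0 x≉0 (sym 0≈xx)) (square-nonneg y)
  ... | yes _   | no y≉0  = nonneg+pos (square-nonneg x) (square-nonneg y , λ 0≈yy → *-≉0 y≉0 y≉0 (sym 0≈yy))

  conjugate-inverse : ∀ x y i → (x * x + y * y) * i ≈ 1# → (x , y) ℂ.* (x * i , - (y * i)) ℂ.≈ ℂ.1#
  conjugate-inverse x y i Ni≈1 =
    trans (solve 3 (λ x y i → x :* (x :* i) :+ (:- con (+ 1)) :* (y :* (:- (y :* i))) := (x :* x :+ y :* y) :* i) refl x y i) Ni≈1 ,
    solve 3 (λ x y i → x :* (:- (y :* i)) :+ y :* (x :* i) := con (+ 0)) refl x y i

  0≉1ᶜ : ¬ (ℂ.0# ℂ.≈ ℂ.1#)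
  0≉1ᶜ (0≈1 , _) = 0≉1 0≈1

  inverseᶜ : ∀ z → ¬ (z ℂ.≈ ℂ.0#) → ∃ λ w → z ℂ.* w ℂ.≈ ℂ.1#
  inverseᶜ (x , y) z≉0 with inverse-pos (norm-pos z≉0)
  ... | i , _ , Ni≈1 = (x * i , - (y * i)) , conjugate-inverse x y i Ni≈1

  _≟ᶜ_ : Decidable ℂ._≈_
  z ≟ᶜ w = proj₁ z ≟ proj₁ w ×-dec proj₂ z ≟ proj₂ w

  open DiscreteField complexRing 0≉1ᶜ inverseᶜ _≟ᶜ_ public
    using () renaming (x≉0∧xy≈0⇒y≈0 to x≉0∧xy≈0⇒y≈0ᶜ)

  module EvaluateAtᶜ = Evaluation commutativeRing complexRing embed-isRingHomomorphism

  -- `ℂ-rawRing` subtracts the product of the imaginary parts, whereas `complexRing` adds `- 1#`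
  -- times it. Carriers and equality agree, so only this difference has to be bridged.
  eval-toℂ[x] : ∀ f z → ℂ[x].eval (toℂ[x] f) z ℂ.≈ EvaluateAtᶜ.ev z f
  eval-toℂ[x] []      z       = refl , refl
  eval-toℂ[x] (a ∷ f) (x , y) with eval-toℂ[x] f (x , y)
  ... | p , q =
    +-congˡ (trans (+-cong (*-congˡ p) (-‿cong (*-congˡ q)))
      (+-congˡ (solve 1 (λ t → :- t := (:- con (+ 1)) :* t) refl _))) ,
    +-congˡ (+-cong (*-congˡ q) (*-congˡ p))

  eval-real : ∀ f x → EvaluateAtᶜ.ev (embed x) f ℂ.≈ embed (eval f x)
  eval-real []      x = refl , refl
  eval-real (a ∷ f) x with eval-real f x
  ... | p , q =
    +-congˡ (trans (+-cong (*-congˡ p) (trans (*-congˡ (*-congˡ q))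
      (solve 0 ((:- con (+ 1)) :* (con (+ 0) :* con (+ 0)) := con (+ 0)) refl))) (+-identityʳ _)) ,
    trans (+-congˡ (+-cong (*-congˡ q) (zeroˡ _)))
      (solve 1 (λ x → con (+ 0) :+ (x :* con (+ 0) :+ con (+ 0)) := con (+ 0)) refl x)

  coeff-toℂ[x] : ∀ f k → ℂ[x].coeff (toℂ[x] f) k ℂ.≈ embed (coeff f k)
  coeff-toℂ[x] []      k       = refl , refl
  coeff-toℂ[x] (a ∷ f) zero    = refl , refl
  coeff-toℂ[x] (a ∷ f) (suc k) = coeff-toℂ[x] f k

-- From the relation `≪` to interlacing lists of zeros

module InterlacingLists {c ℓ₁ ℓ₂} (𝓡 : CompleteOrderedField c ℓ₁ ℓ₂) where
  open RealPolynomial 𝓡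

  degree-unique : ∀ f {m n} → HasDegree f m → HasDegree f n → m ≡ n
  degree-unique f {m} {n} (fₘ≉0 , f>m≈0) (fₙ≉0 , f>n≈0) with <-cmp m n
  ... | tri< m<n _ _ = contradiction (f>m≈0 n m<n) fₙ≉0
  ... | tri≈ _ m≡n _ = m≡n
  ... | tri> _ _ n<m = contradiction (f>n≈0 m n<m) fₘ≉0

  -- Degrees decide: two of the four alternatives would make the degrees equal, and a third would
  -- make that of `f` the larger.
  ≪⇒interlacing-zeros : ∀ f g {n} → HasDegree f n → HasDegree g (suc n) → f ≪ g →
    ∃ λ m → Σ (Fin (suc m) → ℝ) λ r → Σ (Fin m → ℝ) λ s →
      ZerosInDecreasingOrder g r × ZerosInDecreasingOrder f s ×
      (∀ i → r (suc i) ≤ s i × s i ≤ r (inject₁ i))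
  ≪⇒interlacing-zeros f g deg-f deg-g (inj₁ (inj₁ zeros , _)) = zeros
  ≪⇒interlacing-zeros f g deg-f deg-g (inj₁ (inj₂ (_ , _ , _ , ((deg-g′ , _) , _) , ((deg-f′ , _) , _) , _) , _)) =
    contradiction (≡.trans (degree-unique g deg-g deg-g′) (degree-unique f deg-f′ deg-f)) 1+n≢n
  ≪⇒interlacing-zeros f g {n} deg-f deg-g (inj₂ (inj₁ (_ , _ , _ , ((deg-f′ , _) , _) , ((deg-g′ , _) , _) , _) , _)) =
    contradiction (<-trans (n<1+n n) (n<1+n (suc n)))
      (<-irrefl (≡.trans (degree-unique f deg-f deg-f′) (≡.cong suc (degree-unique g deg-g′ deg-g))))
  ≪⇒interlacing-zeros f g deg-f deg-g (inj₂ (inj₂ (_ , _ , _ , ((deg-f′ , _) , _) , ((deg-g′ , _) , _) , _) , _)) =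
    contradiction (≡.trans (degree-unique g deg-g deg-g′) (degree-unique f deg-f′ deg-f)) 1+n≢n

-- Hurwitz stability of the Turán expression

module TuránStability {c ℓ₁ ℓ₂} (𝓡 : CompleteOrderedField c ℓ₁ ℓ₂) where
  open OrderedField 𝓡
  open RealPolynomial 𝓡 hiding (_≈_; -_; _≤_; _<_; 0#; ℝ)
  open RealEvaluation 𝓡
  open CubicSums 𝓡
  open ComplexField 𝓡
  private module ℂ = CommutativeRing complexRing
  open DualNumbers commutativeRing complexRing embed-isRingHomomorphism
  private module D = CommutativeRing dual
  open OmittedProducts dual using () renaming (omit to omitᴰ)
  open RawSemiringDefinitions (Semiring.rawSemiring D.semiring) using () renaming (sum to sumᴰ)
  open Interlacing 𝓡 commutativeRing (Identity.isRingHomomorphism rawRing refl) using (ev-factored)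
  open OmittedProducts commutativeRing using (product-omit)
  open SemiringSum semiring using (*-distribˡ-sum; sum-cong-≋)
  open RawSemiringDefinitions (Semiring.rawSemiring ℂ.semiring) using () renaming (sum to sumᶜ)

  root : ∀ f {n} (r : Fin (suc n) → Carrier) →
    f ≈ₚ C (coeff f (suc n)) *ₚ productₚ (λ i → X -ₚ C (r i)) → ∀ k → eval f (r k) ≈ 0#
  root f {n} r f≈ k = trans (ev-factored (r k) f r f≈) (trans (*-congˡ
    (trans (product-omit (λ i → r k - r i) k) (trans (*-congʳ (-‿inverseʳ (r k))) (zeroˡ _)))) (zeroʳ _))

  root⇒listed : ∀ f {n} (r : Fin n → Carrier) → AllZeros f r → ∀ {x} → eval f x ≈ 0# → ∃ λ k → x ≈ r k
  root⇒listed f r ((fₙ≉0 , _) , f≈) {x} fx≈0 =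
    let k , x-rₖ≈0 = product≈0⇒factor≈0 (λ i → x - r i)
                       (x≉0∧xy≈0⇒y≈0 fₙ≉0 (trans (sym (ev-factored x f r f≈)) fx≈0))
    in k , trans (solve 2 (λ x y → x := (x :- y) :+ y) refl x (r k)) (trans (+-congʳ x-rₖ≈0) (+-identityˡ _))

  -- A polynomial with nonnegative coefficients, not all zero, is positive on the positive axis.
  -- This is the source of Re (z - r k) > 0 in the right half plane.
  roots-nonpos : ∀ f {n} (r : Fin (suc n) → Carrier) → NonnegativeCoefficients f → AllZeros f r →
    ∀ k → r k ≤ 0#
  roots-nonpos f {n} r 0≤f ((fₙ≉0 , _) , f≈) k with pos-or-nonpos (r k)
  ... | inj₂ rₖ≤0 = rₖ≤0
  ... | inj₁ 0<rₖ = contradiction (root f r f≈ k) (pos⇒≉0 (eval-pos f 0≤f (suc n) fₙ≉0 0<rₖ))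


  Σᶜ-re : ∀ {n} (f : Fin n → ℂ.Carrier) → proj₁ (sumᶜ f) ≈ sum (proj₁ ∘ f)
  Σᶜ-re {zero}  f = refl
  Σᶜ-re {suc n} f = +-congˡ (Σᶜ-re (f ∘ suc))

  Σᶜ-im : ∀ {n} (f : Fin n → ℂ.Carrier) → proj₂ (sumᶜ f) ≈ sum (proj₂ ∘ f)
  Σᶜ-im {zero}  f = refl
  Σᶜ-im {suc n} f = +-congˡ (Σᶜ-im (f ∘ suc))

  module _ (f₀ f₁ f₂ p₀ p₁ q h : Poly) {N} (ρ : Fin N → Carrier) (α : Fin N → Fin 4 → Carrier)
    (f₁≈ : f₁ ≈ₚ p₀ *ₚ f₀ +ₚ q *ₚ derivative f₀)
    (f₂≈ : f₂ ≈ₚ p₁ *ₚ f₁ +ₚ q *ₚ derivative f₁)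
    {m} (r : Fin (suc m) → Carrier) (r-zeros : AllZeros f₁ r) (r≤0 : ∀ k → r k ≤ 0#)
    (b : Fin (suc m) → Carrier) (0≤b : ∀ k → 0# ≤ b k)
    (f₀-fractions : ∀ z → Evaluation.ev commutativeRing dual φ+ε0-isHom z f₀ D.≈
      sumᴰ (λ k → (embed (b k) , ℂ.0#) D.* omitᴰ (λ i → z D.- (embed (r i) , ℂ.0#)) k))
    (h-cubic : ∀ k → (X -ₚ C (ρ k)) *ₚ (p₁ -ₚ p₀) +ₚ q ≈ₚ h *ₚ cubicAt (ρ k) (α k))
    (index : Fin (suc m) → Fin N) (r≈ρ : ∀ k → r k ≈ ρ (index k))
    (h-stable : HurwitzStable (toℂ[x] h))
    (α-sign : SameSign (λ y → ∃ λ k → (y ≈ - α k 3F) ⊎ (y ≈ α k 1F) ⊎ (y ≈ α k 0F)))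
    (h-sign : SameSign (λ y → ∃ λ k → ∃ λ x → (0# < x) × (y ≈ eval (h *ₚ cubicAt (ρ k) (α k)) x)))
    where

    private
      open module Formula = TuránFormula.Recurrence 𝓡 complexRing embed-isRingHomomorphism
        f₀ f₁ f₂ p₀ p₁ q h ρ α f₁≈ f₂≈ r (proj₂ r-zeros) b f₀-fractions h-cubic index r≈ρ

      ℑ-poly : Poly
      ℑ-poly = f₁ ^ₚ 2 -ₚ f₂ *ₚ f₀

      signed-A : ∃ λ ε → ε ≉ 0# ×
        (∀ k → 0# ≤ ε * - A k 3F) × (∀ k → 0# ≤ ε * A k 1F) × (∀ k → 0# ≤ ε * A k 0F)
      signed-A with sameSign⇒scaled-nonneg α-sign
      ... | ε , ε≉0 , 0≤ε = ε , ε≉0 ,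
        (λ k → ≤-respʳ-≈ (solve 3 (λ e b a → b :* (e :* :- a) := e :* :- (b :* a)) refl ε (b k) _)
                 (*-nonNeg (0≤b k) (0≤ε (index k , inj₁ refl)))) ,
        (λ k → ≤-respʳ-≈ (solve 3 (λ e b a → b :* (e :* a) := e :* (b :* a)) refl ε (b k) _)
                 (*-nonNeg (0≤b k) (0≤ε (index k , inj₂ (inj₁ refl))))) ,
        (λ k → ≤-respʳ-≈ (solve 3 (λ e b a → b :* (e :* a) := e :* (b :* a)) refl ε (b k) _)
                 (*-nonNeg (0≤b k) (0≤ε (index k , inj₂ (inj₂ refl)))))

      signed-cubic : ∃ λ η → η ≉ 0# ×
        (∀ k x → 0# < x → 0# ≤ η * (eval h x * cubic commutativeRing (A k) (x - r k)))
      signed-cubic with sameSign⇒scaled-nonneg h-sign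
      ... | η , η≉0 , 0≤η = η , η≉0 , λ k x 0<x → ≤-respʳ-≈
        (trans (*-congˡ (*-congˡ (EvaluateCubicAt.ev-*-cubicAt x h (α (index k)) (r≈ρ k))))
          (trans (solve 4 (λ n b h K → b :* (n :* (h :* K)) := n :* (h :* (b :* K))) refl η (b k) (eval h x) _)
            (*-congˡ (*-congˡ (sym (EvaluateCubicAt.cubic-scale x (b k) (α (index k)) (x - r k)))))))
        (*-nonNeg (0≤b k) (0≤η (index k , x , 0<x , refl)))

      vanishing⇒stable : (∀ z → EvaluateAtᶜ.ev z ℑ-poly ℂ.≈ ℂ.0#) → HurwitzStable (toℂ[x] ℑ-poly)
      vanishing⇒stable ≈0 = inj₁ λ k →
        trans (proj₁ (coeff-toℂ[x] ℑ-poly k)) (vanishing⇒≈0 ℑ-poly value≈0 k) , proj₂ (coeff-toℂ[x] ℑ-poly k)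
        where
        value≈0 : ∀ x → eval ℑ-poly x ≈ 0#
        value≈0 x = trans (sym (proj₁ (eval-real ℑ-poly x))) (proj₁ (≈0 (embed x)))

      -- A single zero in the open right half plane already annihilates every weighted cubic. Its
      -- contrapositive is the stability claim once some `A k l` is nonzero.
      ev-ℑ≈0⇒A≈0 : (∀ z → 0# < proj₁ z → ¬ (EvaluateAtᶜ.ev z h ℂ.≈ ℂ.0#)) →
        ∀ x v → 0# < x → EvaluateAtᶜ.ev (x , v) ℑ-poly ℂ.≈ ℂ.0# → ∀ k l → A k l ≈ 0#
      ev-ℑ≈0⇒A≈0 h≉0ᶜ x v 0<x ℑ≈0 =
        let ε , ε≉0 , 0≤-εA₃ , 0≤εA₁ , 0≤εA₀ = signed-A
            η , η≉0 , same-sign = signed-cubic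
        in case-real (v ≟ 0#)
             (real⇒A≈0 h r A r≤0 ε≉0 η≉0 0≤-εA₃ 0≤εA₁ 0≤εA₀ same-sign h≉0 0<x i 0<i norm-inverse)
             (nonreal⇒A≈0 h r A r≤0 ε≉0 η≉0 0≤-εA₃ 0≤εA₁ 0≤εA₀ same-sign h≉0 0<x i 0<i norm-inverse)
        where
        h≉0 : ∀ y → 0# < y → eval h y ≉ 0#
        h≉0 y 0<y hy≈0 = h≉0ᶜ (embed y) 0<y
          (trans (proj₁ (eval-real h y)) hy≈0 , proj₂ (eval-real h y))

        0<u : ∀ k → 0# < x - r k
        0<u k = pos+nonneg 0<x (neg-nonneg (r≤0 k))

        norm-inverses : ∀ k → ∃ λ i → 0# < i × ((x - r k) * (x - r k) + v * v) * i ≈ 1#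
        norm-inverses k = inverse-pos (pos+nonneg (*-pos (0<u k) (0<u k)) (square-nonneg v))

        i : Fin (suc m) → Carrier
        i k = proj₁ (norm-inverses k)

        0<i : ∀ k → 0# < i k
        0<i k = proj₁ (proj₂ (norm-inverses k))

        norm-inverse : ∀ k → ((x - r k) * (x - r k) + v * v) * i k ≈ 1#
        norm-inverse k = proj₂ (proj₂ (norm-inverses k))

        -- This is the conjugate of w = x - r k + i v times 1/|w|², the form of 1/w in which `re`
        -- and `im/v` are written.
        j : Fin (suc m) → ℂ.Carrier
        j k = (x - r k) * i k , - (v * i k)

        ωj≈1 : ∀ k → ω (x , v) k ℂ.* j k ℂ.≈ ℂ.1#
        ωj≈1 k =
          trans (solve 3 (λ u v i → u :* (u :* i) :+ (:- con (+ 1)) :* ((v :- con (+ 0)) :* (:- (v :* i))) :=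
            (u :* u :+ v :* v) :* i) refl (x - r k) v (i k)) (norm-inverse k) ,
          solve 3 (λ u v i → u :* (:- (v :* i)) :+ (v :- con (+ 0)) :* (u :* i) := con (+ 0)) refl (x - r k) v (i k)

        T : Fin (suc m) → ℂ.Carrier
        T k = reciprocalCubic complexRing (embed ∘ A k) (ω (x , v) k) (j k)

        ΣT≈0 : sumᶜ T ℂ.≈ ℂ.0#
        ΣT≈0 = ev-ℑ≈0⇒Σ≈0 (x , v) (λ {z} {w} → x≉0∧xy≈0⇒y≈0ᶜ {z} {w})
          (λ (e≈0 , _) → proj₁ (proj₁ r-zeros) e≈0) (h≉0ᶜ (x , v) 0<x)
          j ωj≈1 (λ k (u≈0 , _) → pos⇒≉0 (0<u k) u≈0) ℑ≈0

        Re Im/v : Fin (suc m) → Carrier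
        Re   = re r A x v i
        Im/v = im/v r A x v i

        T-re : ∀ k → proj₁ (T k) ≈ Re k
        T-re k = solve 7 (λ a₀ a₁ a₂ a₃ u v i →
          let δ = :- con (+ 1) ; O = con (+ 0) ; j₁ = u :* i ; j₂ = :- (v :* i) in
          (a₀ :* (j₁ :* j₁ :+ δ :* (j₂ :* j₂)) :+ δ :* (O :* (j₁ :* j₂ :+ j₂ :* j₁)))
            :+ (a₁ :* j₁ :+ δ :* (O :* j₂)) :+ a₂ :+ (a₃ :* u :+ δ :* (O :* (v :- O))) :=
          a₃ :* u :+ a₂ :+ a₁ :* (u :* i) :+ a₀ :* ((u :* u :- v :* v) :* (i :* i)))
          refl (A k 0F) (A k 1F) (A k 2F) (A k 3F) (x - r k) v (i k)

        T-im : ∀ k → proj₂ (T k) ≈ v * Im/v k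
        -- The imaginary parts of w, 1/w and 1/w² are v, -v / |w|² and -2 (x - r k) v / |w|⁴, so v
        -- factors out of the whole term and can be cancelled when it is nonzero.
        T-im k = solve 6 (λ a₀ a₁ a₃ u v i →
          let δ = :- con (+ 1) ; O = con (+ 0) ; j₁ = u :* i ; j₂ = :- (v :* i) in
          (a₀ :* (j₁ :* j₂ :+ j₂ :* j₁) :+ O :* (j₁ :* j₁ :+ δ :* (j₂ :* j₂)))
            :+ (a₁ :* j₂ :+ O :* j₁) :+ O :+ (a₃ :* (v :- O) :+ O :* u) :=
          v :* (a₃ :- a₁ :* i :- (a₀ :+ a₀) :* (u :* (i :* i))))
          refl (A k 0F) (A k 1F) (A k 3F) (x - r k) v (i k)

        Σre≈0 : sum Re ≈ 0#
        Σre≈0 = trans (sum-cong-≋ {suc m} (sym ∘ T-re)) (trans (sym (Σᶜ-re T)) (proj₁ ΣT≈0))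

        v*Σim≈0 : v * sum Im/v ≈ 0#
        v*Σim≈0 = trans (*-distribˡ-sum v Im/v)
          (trans (sum-cong-≋ {suc m} (sym ∘ T-im)) (trans (sym (Σᶜ-im T)) (proj₂ ΣT≈0)))

        case-real : Dec (v ≈ 0#) →
          (v ≈ 0# → sum Re ≈ 0# → ∀ k l → A k l ≈ 0#) →
          (sum Re ≈ 0# → sum Im/v ≈ 0# → ∀ k l → A k l ≈ 0#) → ∀ k l → A k l ≈ 0#
        case-real (yes v≈0) real nonreal = real v≈0 Σre≈0
        case-real (no v≉0)  real nonreal = nonreal Σre≈0 (x≉0∧xy≈0⇒y≈0 v≉0 v*Σim≈0)

    recurrence-stable : HurwitzStable (toℂ[x] ℑ-poly)
    -- The split is on whether all weighted coefficients vanish, a finite decidable question: one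
    -- answer gives the zero polynomial, the other excludes zeros with positive real part.
    recurrence-stable = by-cases h-stable (all? λ k → all? λ l → A k l ≟ 0#)
      where
      by-cases : HurwitzStable (toℂ[x] h) → Dec (∀ k l → A k l ≈ 0#) → HurwitzStable (toℂ[x] ℑ-poly)
      by-cases (inj₁ h≈0) _ = vanishing⇒stable λ z → ev-h≈0⇒ev-ℑ≈0 z (EvaluateAtᶜ.ev-zero z h λ k →
        trans (sym (proj₁ (coeff-toℂ[x] h k))) (proj₁ (h≈0 k)))
      by-cases (inj₂ _) (yes A≈0) = vanishing⇒stable λ z → A≈0⇒ev-ℑ≈0 z A≈0
      by-cases (inj₂ h≉0) (no A≉0) = inj₂ λ z 0<z ℑ≈0 → A≉0
        (ev-ℑ≈0⇒A≈0 (λ w 0<w h≈0 → h≉0 w 0<w (ℂ.trans (eval-toℂ[x] h w) h≈0))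
          (proj₁ z) (proj₂ z) 0<z (ℂ.trans (ℂ.sym (eval-toℂ[x] ℑ-poly z)) ℑ≈0))

  turán-stable : ∀ (f₀ f₁ f₂ p₀ p₁ q h : Poly) {n} (ρ : Fin n → Carrier) (α : Fin n → Fin 4 → Carrier) →
    NonnegativeCoefficients f₀ → NonnegativeCoefficients f₁ →
    f₁ ≈ₚ p₀ *ₚ f₀ +ₚ q *ₚ derivative f₀ →
    f₂ ≈ₚ p₁ *ₚ f₁ +ₚ q *ₚ derivative f₁ →
    ∀ {m} (r : Fin (suc m) → Carrier) (s : Fin m → Carrier) →
    ZerosInDecreasingOrder f₁ r → ZerosInDecreasingOrder f₀ s →
    (∀ i → r (suc i) ≤ s i × s i ≤ r (inject₁ i)) →
    AllZeros f₁ ρ →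
    (∀ k → (X -ₚ C (ρ k)) *ₚ (p₁ -ₚ p₀) +ₚ q ≈ₚ h *ₚ cubicAt (ρ k) (α k)) →
    HurwitzStable (toℂ[x] h) →
    SameSign (λ y → ∃ λ k → (y ≈ - α k 3F) ⊎ (y ≈ α k 1F) ⊎ (y ≈ α k 0F)) →
    SameSign (λ y → ∃ λ k → ∃ λ x → (0# < x) × (y ≈ eval (h *ₚ cubicAt (ρ k) (α k)) x)) →
    HurwitzStable (toℂ[x] (f₁ ^ₚ 2 -ₚ f₂ *ₚ f₀))
  turán-stable f₀ f₁ f₂ p₀ p₁ q h ρ α 0≤f₀ 0≤f₁ f₁≈ f₂≈ r s (r-zeros , r↘) (s-zeros , _) r≤s≤r ρ-zeros
    h-cubic h-stable α-sign h-sign =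
    let b , 0≤b , f₀-fractions = Interlacing.interlacing⇒partial-fractions 𝓡 dual φ+ε0-isHom f₀ r s 0≤f₀ s-zeros r↘ r≤s≤r
    in recurrence-stable f₀ f₁ f₂ p₀ p₁ q h ρ α f₁≈ f₂≈ r r-zeros (roots-nonpos f₁ r 0≤f₁ r-zeros) b 0≤b f₀-fractions
         h-cubic (proj₁ ∘ listed) (proj₂ ∘ listed) h-stable α-sign h-sign
    where
    listed : ∀ k → ∃ λ j → r k ≈ ρ j
    listed k = root⇒listed f₁ ρ ρ-zeros (root f₁ r (proj₂ r-zeros) k)

theorem3p2 : ∀ {c ℓ₁ ℓ₂} (𝓡 : CompleteOrderedField c ℓ₁ ℓ₂) →
    let open RealPolynomial 𝓡 in
    (P p h : ℕ → Poly) (q : Poly)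
    (r : ∀ n → Fin n → ℝ) (a : ∀ n → Fin n → Fin 4 → ℝ) →
    (∀ n → NonnegativeCoefficients (P n)) →
    (∀ n → HasDegree (P n) n) →
    (∀ n → P (suc n) ≈ₚ p n *ₚ P n +ₚ q *ₚ derivative (P n)) →
    (∀ n → P n ≪ P (suc n)) →
    (∀ n → 1 ≤ℕ n → AllZeros (P n) (r n)) →
    (∀ n → 1 ≤ℕ n → ∀ k →
    (X -ₚ C (r n k)) *ₚ (p n -ₚ p (pred n)) +ₚ q ≈ₚ h n *ₚ cubicAt (r n k) (a n k)) →
    (∀ n → 1 ≤ℕ n → HurwitzStable (toℂ[x] (h n))) →
    (∀ n → 1 ≤ℕ n →
    SameSign (λ y → ∃ λ k → (y ≈ - a n k 3F) ⊎ (y ≈ a n k 1F) ⊎ (y ≈ a n k 0F))) →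
    (∀ n → 1 ≤ℕ n →
    SameSign (λ y → ∃ λ k → ∃ λ x → (0# < x) × (y ≈ eval (h n *ₚ cubicAt (r n k) (a n k)) x))) →
    ∀ n → HurwitzStable (toℂ[x] (ℑ P n))
theorem3p2 𝓡 P p h q r a 0≤P deg-P P≈ P≪P r-zeros h-cubic h-stable a-sign h-sign n =
  -- The hypotheses on zeros and cubics are taken at `N` = n + 1, the index of the middle
  -- polynomial. This covers n = 0, and `pred N` reduces to n.
  let m , ρ , s , ρ-zeros , s-zeros , ρ≤s≤ρ = ≪⇒interlacing-zeros (P n) (P N) (deg-P n) (deg-P N) (P≪P n)
  in turán-stable (P n) (P N) (P (suc N)) (p n) (p N) q (h N) (r N) (a N) (0≤P n) (0≤P N) (P≈ n) (P≈ N)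
       ρ s ρ-zeros s-zeros ρ≤s≤ρ (r-zeros N 1≤N) (h-cubic N 1≤N) (h-stable N 1≤N) (a-sign N 1≤N) (h-sign N 1≤N)
  where
  open InterlacingLists 𝓡
  open TuránStability 𝓡
  N = suc n
  1≤N : 1 ≤ℕ N
  1≤N = s≤s z≤n
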